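{- \textsc{Diam-Cluster-Completion} is in $\mathsf{XP}$ parameterized by $k$; that is, there is an algorithm that decides every instance $(M,k,r)$ of \textsc{Diam-Cluster-Completion} in time $O(|I|^{f(k)})$ for some computable function $f$, where $|I|$ is the size of the instance.
   Context: The symbol $\square$ denotes a missing entry. For $\vec a,\vec b\in\{0,1,\square\}^d$, let $\delta(\vec a,\vec b)$ be the number of coordinates $i\in[d]=\{1,\dots,d\}$ with $\{\vec a[i],\vec b[i]\}=\{0,1\}$. A multiset $M^*$ of vectors in $\{0,1\}^d$ is a completion of a multiset $M$ of vectors in $\{0,1,\square\}^d$ if there is a bijection $\alpha:M\to M^*$ such that for all $\vec a\in M$ and $i\in[d]$, either $\vec a[i]=\square$ or $\alpha(\vec a)[i]=\vec a[i]$. \textsc{Diam-Cluster-Completion}: given a finite multiset $M$ of vectors in $\{0,1,\square\}^d$ and $k,r\in\mathbb N$, decide whether there is a completion $M^*$ of $M$ containing a sub-multiset $P$ of $k$ vectors with $\delta(\vec p,\vec q)\le r$ for all $\vec p,\vec q\in P$. -}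

module Defs where

open import Data.Bool using (Bool; true; false)
import Data.Bool.Properties as Bool
open import Data.Fin using (Fin)
open import Data.List using (List; []; _∷_; _++_; length)
import Data.List as List
open import Data.List.Membership.Propositional using (_∈_)
open import Data.List.Relation.Binary.Permutation.Propositional using (_↭_)
open import Data.Maybe using (Maybe; just; nothing)
import Data.Maybe.Properties as Maybe
open import Data.Nat using (ℕ; suc; _+_; _*_; _^_; _≤_)
open import Data.Nat.Binary using (ℕᵇ; 2[1+_]; 1+[2_]; fromℕ)
import Data.Nat.Binary as ℕᵇ
open import Data.Product using (Σ-syntax; ∃-syntax; _×_; _,_)
open import Data.Sum using (_⊎_)
open import Data.Vec using (Vec; []; _∷_)
import Data.Vec as Vec
open import Function.Bundles using (_⤖_; Bijection)
open import Relation.Binary.Definitions using (DecidableEquality)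
open import Relation.Binary.PropositionalEquality using (_≡_)
open import Relation.Nullary.Decidable using (_×-dec_; _⊎-dec_)
open import Relation.Nullary.Reflects using (Reflects)
open import Relation.Unary using (Decidable)

-- First-order call-by-value recursive programs over binary trees.  A
-- program is a finite syntactic object, fixed before its input.  Its running
-- time is the number of evaluation rules applied.  This is a reasonable cost
-- model (polynomially equivalent to Turing machines): with trees stored as
-- pointers, a rule allocates at most one tree cell and inspects at most one,
-- so t rules use at most (input size + t) cells even if shared subtrees
-- unfold to something larger.  There is no unit-cost arithmetic and no unit-cost
-- equality test on trees.

data Tree : Set where
  leaf : Tree
  node : Tree → Tree → Tree

size : Tree → ℕ
size leaf       = 1
size (node s t) = suc (size s + size t)

-- Expressions over n variables and m functions with the given arities.
data Expr {m : ℕ} (arity : Vec ℕ m) (n : ℕ) : Set where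
  var  : Fin n → Expr arity n
  leaf : Expr arity n
  node : Expr arity n → Expr arity n → Expr arity n
  -- The second branch sees the two children as variables 0 and 1.
  case : Expr arity n → Expr arity n → Expr arity (2 + n) → Expr arity n
  call : (f : Fin m) → Vec (Expr arity n) (Vec.lookup arity f) → Expr arity n

record Program : Set where
  field
    {functions} : ℕ
    arity       : Vec ℕ functions
    body        : (f : Fin functions) → Expr arity (Vec.lookup arity f)
    main        : Expr arity 1

module Semantics (p : Program) where
  open Program p

  infix 4 _⊢_⇓_[_] _⊢*_⇓_[_]

  -- ρ ⊢ e ⇓ v [ t ]: in environment ρ, e evaluates to v in time t.
  data _⊢_⇓_[_]  {n} (ρ : Vec Tree n) : Expr arity n → Tree → ℕ → Set
  data _⊢*_⇓_[_] {n} (ρ : Vec Tree n) :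
    ∀ {l} → Vec (Expr arity n) l → Vec Tree l → ℕ → Set

  data _⊢_⇓_[_] {n} ρ where
    var : ∀ x → ρ ⊢ var x ⇓ Vec.lookup ρ x [ 1 ]

    leaf : ρ ⊢ leaf ⇓ leaf [ 1 ]

    node : ∀ {e₁ e₂ v₁ v₂ t₁ t₂} →
           ρ ⊢ e₁ ⇓ v₁ [ t₁ ] →
           ρ ⊢ e₂ ⇓ v₂ [ t₂ ] →
           ρ ⊢ node e₁ e₂ ⇓ node v₁ v₂ [ suc (t₁ + t₂) ]

    case-leaf : ∀ {e e₁ e₂ v t t′} →
                ρ ⊢ e ⇓ leaf [ t ] →
                ρ ⊢ e₁ ⇓ v [ t′ ] →
                ρ ⊢ case e e₁ e₂ ⇓ v [ suc (t + t′) ]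

    case-node : ∀ {e e₁ e₂ v₁ v₂ v t t′} →
                ρ ⊢ e ⇓ node v₁ v₂ [ t ] →
                (v₁ ∷ v₂ ∷ ρ) ⊢ e₂ ⇓ v [ t′ ] →
                ρ ⊢ case e e₁ e₂ ⇓ v [ suc (t + t′) ]

    call : ∀ {f es vs v t t′} →
           ρ ⊢* es ⇓ vs [ t ] →
           vs ⊢ body f ⇓ v [ t′ ] →
           ρ ⊢ call f es ⇓ v [ suc (t + t′) ]

  data _⊢*_⇓_[_] {n} ρ where
    []  : ρ ⊢* [] ⇓ [] [ 0 ]

    _∷_ : ∀ {l e v t t′} {es : Vec (Expr arity n) l} {vs : Vec Tree l} →
          ρ ⊢ e ⇓ v [ t ] →
          ρ ⊢* es ⇓ vs [ t′ ] →
          ρ ⊢* e ∷ es ⇓ v ∷ vs [ t + t′ ]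

_on_outputs_within_ : Program → Tree → Tree → ℕ → Set
p on input outputs v within b =
  ∃[ t ] (input ∷ []) ⊢ Program.main p ⇓ v [ t ] × t ≤ b
  where open Semantics p

encodeBool : Bool → Tree
encodeBool false = leaf
encodeBool true  = node leaf leaf

encodeMaybe : ∀ {A : Set} → (A → Tree) → Maybe A → Tree
encodeMaybe enc nothing  = leaf
encodeMaybe enc (just x) = node (enc x) leaf

encodeList : ∀ {A : Set} → (A → Tree) → List A → Tree
encodeList enc []       = leaf
encodeList enc (x ∷ xs) = node (enc x) (encodeList enc xs)

encodeℕᵇ : ℕᵇ → Tree
encodeℕᵇ ℕᵇ.zero  = leaf
encodeℕᵇ 2[1+ n ] = node (encodeBool true)  (encodeℕᵇ n)
encodeℕᵇ 1+[2 n ] = node (encodeBool false) (encodeℕᵇ n)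

-- Numbers are written in (bijective) binary, so size (encodeℕ n) = Θ(log n).
encodeℕ : ℕ → Tree
encodeℕ n = encodeℕᵇ (fromℕ n)

record ParameterizedProblem : Set₁ where
  field
    Instance  : Set
    Yes       : Instance → Set
    parameter : Instance → ℕ
    encode    : Instance → Tree

Computable : (ℕ → ℕ) → Set
Computable f =
  Σ[ p ∈ Program ] (∀ n → ∃[ t ] p on encodeℕ n outputs encodeℕ (f n) within t)

InXP : ParameterizedProblem → Set
InXP Π =
  Σ[ p ∈ Program ] Σ[ f ∈ (ℕ → ℕ) ] Computable f × (∃[ c ] (∀ I →
    ∃[ answer ]
      Reflects (Yes I) answer ×
      p on encode I outputs encodeBool answer
        within (c * size (encode I) ^ f (parameter I))))
  where open ParameterizedProblem Π

Entry : Set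
Entry = Maybe Bool

pattern □ = nothing
pattern 𝟎 = just false
pattern 𝟏 = just true

_≟_ : DecidableEquality Entry
_≟_ = Maybe.≡-dec Bool._≟_

Conflict : Entry × Entry → Set
Conflict (x , y) = (x ≡ 𝟎 × y ≡ 𝟏) ⊎ (x ≡ 𝟏 × y ≡ 𝟎)

conflict? : Decidable Conflict
conflict? (x , y) = ((x ≟ 𝟎) ×-dec (y ≟ 𝟏)) ⊎-dec ((x ≟ 𝟏) ×-dec (y ≟ 𝟎))

δ : ∀ {d} → Vec Entry d → Vec Entry d → ℕ
δ a b = Vec.count conflict? (Vec.zip a b)

embed : ∀ {d} → Vec Bool d → Vec Entry d
embed = Vec.map just

-- Multisets are lists up to permutation; the elements of a multiset, counted
-- with multiplicity, are the positions of the list.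

_IsCompletionOf_ : ∀ {d} → List (Vec Bool d) → List (Vec Entry d) → Set
_IsCompletionOf_ {d} M* M =
  Σ[ α ∈ Fin (length M) ⤖ Fin (length M*) ] (∀ (j : Fin (length M)) (i : Fin d) →
    let a  = List.lookup M j
        αa = embed (List.lookup M* (Bijection.to α j))
    in Vec.lookup a i ≡ □ ⊎ Vec.lookup αa i ≡ Vec.lookup a i)

_IsSubMultisetOf_ : ∀ {A : Set} → List A → List A → Set
P IsSubMultisetOf M = ∃[ Q ] P ++ Q ↭ M

record DiamInstance : Set where
  field
    {d} : ℕ
    M   : List (Vec Entry d)
    k r : ℕ

HasDiamCluster : DiamInstance → Set
HasDiamCluster I =
  ∃[ M* ] M* IsCompletionOf M × (∃[ P ]
    P IsSubMultisetOf M* ×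
    length P ≡ k ×
    (∀ {p q} → p ∈ P → q ∈ P → δ (embed p) (embed q) ≤ r))
  where open DiamInstance I

encodeVector : ∀ {d} → Vec Entry d → Tree
encodeVector a = encodeList (encodeMaybe encodeBool) (Vec.toList a)

-- The dimension d is not written separately: it is the length of any vector
-- of M, and is irrelevant if there is none.
encodeInstance : DiamInstance → Tree
encodeInstance I = node (encodeList encodeVector M) (node (encodeℕ k) (encodeℕ r))
  where open DiamInstance I

DiamClusterCompletion : ParameterizedProblem
DiamClusterCompletion = record
  { Instance  = DiamInstance
  ; Yes       = HasDiamCluster
  ; parameter = DiamInstance.k
  ; encode    = encodeInstance
  }

module Submission where

open import Data.Bool using (Bool; true; false; _xor_)
open import Data.Empty using (⊥; ⊥-elim)
open import Data.Fin using (Fin; zero; suc)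
open import Data.Fin.Permutation using (cast-id)
open import Data.Fin.Properties using (all?)
open import Data.List using (List; []; _∷_; _++_; _ʳ++_; length; map; reverse; tabulate)
import Data.List as List
open import Data.List.Membership.Propositional using (_∈_)
open import Data.List.Properties
  using (length-++; length-map; map-ʳ++; length-reverse; tabulate-lookup)
open import Data.List.Relation.Binary.BagAndSetEquality using (∼bag⇒↭)
open import Data.List.Relation.Binary.Permutation.Propositional
  using (_↭_; ↭-refl; ↭-sym; ↭-trans; prep; swap)
import Data.List.Relation.Binary.Permutation.Propositional as ↭
open import Data.List.Relation.Binary.Permutation.Propositional.Properties
  using (↭-length; ↭-reverse; ∈-resp-↭)
open import Data.List.Relation.Binary.Pointwise using (Pointwise; []; _∷_; Pointwise-length)
import Data.List.Relation.Binary.Pointwise as Pointwise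
open import Data.List.Relation.Ternary.Interleaving.Properties using (interleave-length)
open import Data.List.Relation.Ternary.Interleaving.Propositional
  using (Interleaving; []; consˡ; consʳ; toPermutation)
open import Data.List.Relation.Unary.All using (All; []; _∷_)
import Data.List.Relation.Unary.All as All
import Data.List.Relation.Unary.All.Properties as All
open import Data.List.Relation.Unary.Any using (Any; here; there)
open import Data.List.Relation.Unary.Any.Properties using (tabulate⁺; tabulate⁻)
open import Data.Maybe using (just)
open import Data.Nat
  using (ℕ; zero; suc; _+_; _*_; _^_; _⊓_; _≤_; _<_; z≤n; s≤s; z<s; >-nonZero; NonZero)
open import Data.Nat.Binary using (ℕᵇ; 2[1+_]; 1+[2_])
import Data.Nat.Binary as ℕᵇ
import Data.Nat.Binary.Properties as ℕᵇ
open import Data.Nat.Properties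
open import Data.Nat.Tactic.RingSolver using (solve-∀)
open import Data.Product using (∃-syntax; _×_; _,_; proj₁; proj₂; map₁)
import Data.Product.Function.Dependent.Propositional as Σ
open import Data.Sum using (_⊎_; inj₁; inj₂; [_,_]′)
open import Data.Unit using (⊤)
open import Data.Vec using (Vec; []; _∷_; lookup)
import Data.Vec as Vec
import Data.Vec.Properties as Vec
open import Function using (_∘_; id)
open import Function.Bundles using (_⤖_; _↔_; Bijection; mk↔ₛ′)
open import Function.Construct.Composition using (_↔-∘_)
open import Function.Construct.Identity using (↔-id)
open import Function.Construct.Symmetry using (↔-sym)
open import Function.Properties.Bijection using (⤖⇒↔)
open import Function.Properties.Inverse using (↔⇒⤖)
open import Relation.Binary.PropositionalEquality
open import Relation.Nullary using (¬_)
open import Relation.Nullary.Decidable using (from-yes)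
open import Relation.Nullary.Reflects using (Reflects; ofʸ; ofⁿ)
open import Defs

-- Try all choices of k rows of M.  For a fixed choice, go through the columns
-- and maintain the set of vectors of remaining distance budgets, one coordinate
-- for each of the k(k-1)/2 pairs of rows.  A column replaces the set by the union,
-- over the at most 2ᵏ completions of the column, of its translates by the pairs of
-- rows that the completion makes different.  Initially all budgets up to
-- min(r, d) are present, so the set has at most (d + 1)^(k²) elements, and the
-- choice is good if and only if the zero vector survives all columns.

-- Budgets that only decrease keep the sets small: every set that arises stays in the box of the
-- initial one, however many columns there are. Counting the translates would instead multiply the
-- bound by `2^k` for each column. The machine model has no arithmetic, so a budget is a position in
-- a list of sections, and lowering it deletes the first section. Numbers that drive a recursion
-- have to be unary, but `r` is given in binary and its value may be exponential in the input size;
-- hence the truncation at `d`. The exponent of the time bound must itself be computed by a program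
-- of the same model, and the leading constant may not depend on `k`, so all factors that grow with
-- `k` are absorbed into a power of the input size.

caseTree : ∀ {A : Set} → Tree → A → (Tree → Tree → A) → A
caseTree leaf       l n = l
caseTree (node s t) l n = n s t

-- Denotations and running times of expressions

module _ {m} {arity : Vec ℕ m} where

  ∣_∣ᵉ  : ∀ {n} → Expr arity n → ℕ
  ∣_∣ᵉ* : ∀ {n l} → Vec (Expr arity n) l → ℕ

  ∣ var x ∣ᵉ        = 1
  ∣ leaf ∣ᵉ         = 1
  ∣ node e₁ e₂ ∣ᵉ   = suc (∣ e₁ ∣ᵉ + ∣ e₂ ∣ᵉ)
  ∣ case e e₁ e₂ ∣ᵉ = suc (∣ e ∣ᵉ + (∣ e₁ ∣ᵉ + ∣ e₂ ∣ᵉ))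
  ∣ call f es ∣ᵉ    = suc ∣ es ∣ᵉ*

  ∣ [] ∣ᵉ*     = 0
  ∣ e ∷ es ∣ᵉ* = ∣ e ∣ᵉ + ∣ es ∣ᵉ*

-- F and C are the intended value of, and bound on the number of calls made by,
-- each function; relative to them evaluation is structurally recursive.
module Denotation {m} (arity : Vec ℕ m)
  (F : (f : Fin m) → Vec Tree (lookup arity f) → Tree)
  (C : (f : Fin m) → Vec Tree (lookup arity f) → ℕ) where

  ⟦_⟧  : ∀ {n} → Expr arity n → Vec Tree n → Tree
  ⟦_⟧* : ∀ {n l} → Vec (Expr arity n) l → Vec Tree n → Vec Tree l

  ⟦ var x ⟧        ρ = lookup ρ x
  ⟦ leaf ⟧         ρ = leaf
  ⟦ node e₁ e₂ ⟧   ρ = node (⟦ e₁ ⟧ ρ) (⟦ e₂ ⟧ ρ)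
  ⟦ case e e₁ e₂ ⟧ ρ = caseTree (⟦ e ⟧ ρ) (⟦ e₁ ⟧ ρ) (λ s t → ⟦ e₂ ⟧ (s ∷ t ∷ ρ))
  ⟦ call f es ⟧    ρ = F f (⟦ es ⟧* ρ)

  ⟦ [] ⟧*     ρ = []
  ⟦ e ∷ es ⟧* ρ = ⟦ e ⟧ ρ ∷ ⟦ es ⟧* ρ

  calls  : ∀ {n} → Expr arity n → Vec Tree n → ℕ
  calls* : ∀ {n l} → Vec (Expr arity n) l → Vec Tree n → ℕ

  calls (var x)        ρ = 0
  calls leaf           ρ = 0
  calls (node e₁ e₂)   ρ = calls e₁ ρ + calls e₂ ρ
  calls (case e e₁ e₂) ρ =
    calls e ρ + caseTree (⟦ e ⟧ ρ) (calls e₁ ρ) (λ s t → calls e₂ (s ∷ t ∷ ρ))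
  calls (call f es)    ρ = calls* es ρ + C f (⟦ es ⟧* ρ)

  calls* []       ρ = 0
  calls* (e ∷ es) ρ = calls e ρ + calls* es ρ

-- Termination comes for free: a body costs strictly less than its call, so
-- the bound itself is the termination measure.  Time is linear in the number
-- of calls because a call-free evaluation visits each subexpression at most once.
module Adequacy (p : Program)
  (F : (f : Fin (Program.functions p)) → Vec Tree (lookup (Program.arity p) f) → Tree)
  (C : (f : Fin (Program.functions p)) → Vec Tree (lookup (Program.arity p) f) → ℕ)
  (F-correct : ∀ f vs → Denotation.⟦_⟧ (Program.arity p) F C (Program.body p f) vs ≡ F f vs)
  (C-correct : ∀ f vs → Denotation.calls (Program.arity p) F C (Program.body p f) vs < C f vs)
  (K : ℕ) (bodies≤K : ∀ f → ∣ Program.body p f ∣ᵉ ≤ K) where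

  open Program p
  open Denotation arity F C
  open Semantics p

  private
    regroup : ∀ K a b x y → a + K * x + (b + K * y) ≡ a + b + K * (x + y)
    regroup = solve-∀

    sum-bound : ∀ {t u} a b x y → t ≤ a + K * x → u ≤ b + K * y →
                t + u ≤ a + b + K * (x + y)
    sum-bound a b x y t≤ u≤ = ≤-trans (+-mono-≤ t≤ u≤) (≤-reflexive (regroup K a b x y))

    call-bound : ∀ K a x y → K + K * y + (a + K * x) ≡ a + K * (x + suc y)
    call-bound = solve-∀

  eval : ∀ B {n} (e : Expr arity n) ρ → calls e ρ ≤ B →
         ∃[ t ] ρ ⊢ e ⇓ ⟦ e ⟧ ρ [ t ] × t ≤ ∣ e ∣ᵉ + K * calls e ρ
  eval* : ∀ B {n l} (es : Vec (Expr arity n) l) ρ → calls* es ρ ≤ B →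
          ∃[ t ] ρ ⊢* es ⇓ ⟦ es ⟧* ρ [ t ] × t ≤ ∣ es ∣ᵉ* + K * calls* es ρ

  eval B (var x) ρ _ = 1 , var x , m≤m+n 1 _
  eval B leaf    ρ _ = 1 , leaf , m≤m+n 1 _
  eval B (node e₁ e₂) ρ ≤B
    with t₁ , d₁ , b₁ ← eval B e₁ ρ (m+n≤o⇒m≤o _ ≤B)
       | t₂ , d₂ , b₂ ← eval B e₂ ρ (m+n≤o⇒n≤o (calls e₁ ρ) ≤B)
    = _ , node d₁ d₂ , s≤s (sum-bound ∣ e₁ ∣ᵉ ∣ e₂ ∣ᵉ _ _ b₁ b₂)
  eval B (case e e₁ e₂) ρ ≤B
    with ⟦ e ⟧ ρ | eval B e ρ (m+n≤o⇒m≤o _ ≤B) | m+n≤o⇒n≤o (calls e ρ) ≤B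
  ... | leaf | t , d , b | ≤B′
    with t₁ , d₁ , b₁ ← eval B e₁ ρ ≤B′
    = _ , case-leaf d d₁ ,
      s≤s (sum-bound ∣ e ∣ᵉ _ _ _ b (≤-trans b₁ (+-monoˡ-≤ (K * calls e₁ ρ) (m≤m+n ∣ e₁ ∣ᵉ ∣ e₂ ∣ᵉ))))
  ... | node u v | t , d , b | ≤B′
    with t₁ , d₁ , b₁ ← eval B e₂ (u ∷ v ∷ ρ) ≤B′
    = _ , case-node d d₁ ,
      s≤s (sum-bound ∣ e ∣ᵉ _ _ _ b (≤-trans b₁ (+-monoˡ-≤ (K * calls e₂ (u ∷ v ∷ ρ)) (m≤n+m ∣ e₂ ∣ᵉ ∣ e₁ ∣ᵉ))))
  eval B (call f es) ρ ≤B
    with t , d , b ← eval* B es ρ (m+n≤o⇒m≤o _ ≤B)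
    with C f (⟦ es ⟧* ρ) | C-correct f (⟦ es ⟧* ρ) | m+n≤o⇒n≤o (calls* es ρ) ≤B
  eval (suc B) (call f es) ρ ≤B | suc c | s≤s calls≤c | s≤s c≤B
    with t′ , d′ , b′ ← eval B (body f) (⟦ es ⟧* ρ) (≤-trans calls≤c c≤B)
    = _ , call d (subst (λ v → ⟦ es ⟧* ρ ⊢ body f ⇓ v [ t′ ]) (F-correct f (⟦ es ⟧* ρ)) d′) , s≤s (begin
        t + t′                                          ≡⟨ +-comm t t′ ⟩
        t′ + t                                          ≤⟨ +-mono-≤ b′ b ⟩
        ∣ body f ∣ᵉ + K * calls (body f) (⟦ es ⟧* ρ) + (∣ es ∣ᵉ* + K * calls* es ρ)
          -- Strictness in `C-correct` leaves one unit of `C` over; at rate `K` it pays for one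
          -- traversal of the body.
          ≤⟨ +-monoˡ-≤ _ (+-mono-≤ (bodies≤K f) (*-monoʳ-≤ K calls≤c)) ⟩
        K + K * c + (∣ es ∣ᵉ* + K * calls* es ρ)        ≡⟨ call-bound K ∣ es ∣ᵉ* (calls* es ρ) c ⟩
        ∣ es ∣ᵉ* + K * (calls* es ρ + suc c)            ∎)
    where open ≤-Reasoning

  eval* B []       ρ _ = 0 , [] , z≤n
  eval* B (e ∷ es) ρ ≤B
    with t₁ , d₁ , b₁ ← eval B e ρ (m+n≤o⇒m≤o _ ≤B)
       | t₂ , d₂ , b₂ ← eval* B es ρ (m+n≤o⇒n≤o (calls e ρ) ≤B)
    = _ , d₁ ∷ d₂ , sum-bound ∣ e ∣ᵉ ∣ es ∣ᵉ* _ _ b₁ b₂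

  -- The hypothesis `1 ≤ n` lets the size of `main`, which is paid even if no call is made, be
  -- absorbed into the multiple of `n`.
  outputs : ∀ v {w n} → ⟦ main ⟧ (v ∷ []) ≡ w → calls main (v ∷ []) ≤ n → 1 ≤ n →
            p on v outputs w within ((∣ main ∣ᵉ + K) * n)
  outputs v {n = n} refl calls≤n 1≤n with t , d , b ← eval _ main (v ∷ []) ≤-refl
    = t , d , (begin
      t                                   ≤⟨ b ⟩
      ∣ main ∣ᵉ + K * calls main (v ∷ []) ≤⟨ +-mono-≤ (m≤m*n ∣ main ∣ᵉ n {{>-nonZero 1≤n}})
                                                      (*-monoʳ-≤ K calls≤n) ⟩
      ∣ main ∣ᵉ * n + K * n               ≡⟨ *-distribʳ-+ n ∣ main ∣ᵉ K ⟨
      (∣ main ∣ᵉ + K) * n                 ∎)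
    where open ≤-Reasoning

-- The program

pattern x0 = var zero
pattern x1 = var (suc zero)
pattern x2 = var (suc (suc zero))
pattern x3 = var (suc (suc (suc zero)))
pattern x4 = var (suc (suc (suc (suc zero))))
pattern x5 = var (suc (suc (suc (suc (suc zero)))))
pattern x6 = var (suc (suc (suc (suc (suc (suc zero))))))
pattern x7 = var (suc (suc (suc (suc (suc (suc (suc zero)))))))
pattern x8 = var (suc (suc (suc (suc (suc (suc (suc (suc zero))))))))

pattern DOUBLE    = zero
pattern PRED      = suc DOUBLE
pattern EXPONENT  = suc PRED
pattern CAP       = suc EXPONENT
pattern UNION     = suc CAP
pattern SHIFT     = suc UNION
pattern SHIFTEACH = suc SHIFT
pattern XOREACH   = suc SHIFTEACH
pattern COSTS     = suc XOREACH
pattern STEP      = suc COSTS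
pattern TAILS     = suc STEP
pattern PROCESS   = suc TAILS
pattern REPEAT    = suc PROCESS
pattern WRAP      = suc REPEAT
pattern FULL      = suc WRAP
pattern CHECK     = suc FULL
pattern TEST      = suc CHECK
pattern SELECT    = suc TEST

arities : Vec ℕ 18
arities = 1 ∷ 1 ∷ 1 ∷ 2 ∷ 2 ∷ 2 ∷ 2 ∷ 3 ∷ 1 ∷ 3 ∷ 1 ∷ 3 ∷ 2 ∷ 3 ∷ 2 ∷ 2 ∷ 2 ∷ 4 ∷ []

pattern tt = node leaf leaf

literal : ∀ {n} → Tree → Expr arities n
literal leaf       = leaf
literal (node s t) = node (literal s) (literal t)

-- The constant part of the exponent; its value is immaterial as long as it is large.
exponent₀ : ℕᵇ
exponent₀ = 2[1+ 2[1+ 2[1+ 2[1+ 2[1+ 2[1+ 2[1+ 2[1+ ℕᵇ.zero ] ] ] ] ] ] ] ]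

bodies : (f : Fin 18) → Expr arities (lookup arities f)
bodies DOUBLE = case x0 leaf
  (case x0 (node tt (call DOUBLE (x1 ∷ [])))
           (node tt (node leaf x3)))
bodies PRED = case x0 leaf
  (case x0 (call DOUBLE (x1 ∷ []))
           (node leaf x3))
bodies EXPONENT = case x0 (literal (encodeℕᵇ exponent₀))
  (call DOUBLE (call DOUBLE (call EXPONENT (x1 ∷ []) ∷ []) ∷ []))
bodies CAP = case x0 leaf
  (case x3 leaf (node leaf (call CAP (x3 ∷ call PRED (x5 ∷ []) ∷ []))))
bodies UNION = case x0 x1
  (case x3 x2 (node (call UNION (x2 ∷ x0 ∷ [])) (call UNION (x3 ∷ x1 ∷ []))))
bodies SHIFT = case x0 x1
  (call SHIFTEACH (x1 ∷ case x0 x3 (case x5 leaf x1) ∷ []))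
bodies SHIFTEACH = case x1 leaf
  (node (call SHIFT (x2 ∷ x0 ∷ [])) (call SHIFTEACH (x2 ∷ x1 ∷ [])))
bodies XOREACH = case x1 x2
  (node (case x2 x0 (case x2 tt leaf)) (call XOREACH (x2 ∷ x1 ∷ x4 ∷ [])))
bodies COSTS = case x0 leaf
  (call XOREACH (x0 ∷ x1 ∷ call COSTS (x1 ∷ []) ∷ []))
bodies STEP = case x0 (call SHIFT (call COSTS (x1 ∷ []) ∷ x2 ∷ []))
  (case x0 x4
    (case x0
      (call UNION (call STEP (x3 ∷ node leaf x5 ∷ x6 ∷ []) ∷
                   call STEP (x3 ∷ node tt   x5 ∷ x6 ∷ []) ∷ []))
      (call STEP (x5 ∷ node x0 x7 ∷ x8 ∷ []))))
bodies TAILS = case x0 leaf (node (case x0 leaf x1) (call TAILS (x1 ∷ [])))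
bodies PROCESS = case x0 (call CHECK (call COSTS (x1 ∷ []) ∷ x2 ∷ []))
  (call PROCESS (x1 ∷ call TAILS (x3 ∷ []) ∷ call STEP (x3 ∷ leaf ∷ x4 ∷ []) ∷ []))
bodies REPEAT = case x0 (node x1 leaf) (node x3 (call REPEAT (x1 ∷ x3 ∷ [])))
bodies WRAP = case x0 x2
  (call REPEAT (x3 ∷ call WRAP (x1 ∷ x3 ∷ x4 ∷ []) ∷ []))
bodies FULL = case x0 tt
  (call WRAP (x1 ∷ x3 ∷ call FULL (x1 ∷ x3 ∷ []) ∷ []))
bodies CHECK = case x0 (case x1 leaf tt)
  (case x3 leaf (call CHECK (x3 ∷ x0 ∷ [])))
bodies TEST = case x0 tt (call PROCESS (x0 ∷ x2 ∷ call FULL (x2 ∷ x3 ∷ []) ∷ []))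
bodies SELECT = case x0 (call TEST (x2 ∷ x3 ∷ []))
  (case x3 leaf
    (case (call SELECT (x3 ∷ x1 ∷ node x0 x6 ∷ x7 ∷ []))
      (call SELECT (x4 ∷ x1 ∷ x6 ∷ x7 ∷ []))
      tt))

program : Expr arities 1 → Program
program e = record { arity = arities ; body = bodies ; main = e }

decide : Expr arities 1
decide = case x0 leaf (case x1 leaf (call SELECT
  ( call CAP (node leaf x2 ∷ x0 ∷ []) ∷ x2 ∷ leaf
  ∷ call CAP (case x2 leaf x0 ∷ x1 ∷ []) ∷ [])))

-- Intended values of the functions

-- Bijective binary has the digits 1 and 2, lowest first. Twice `1 + 2n` is digit 2 followed by
-- `2n`; twice `2 + 2n` is digit 2 followed by `1 + 2n`, where the recursion stops.
doubleᵗ : Tree → Tree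
doubleᵗ leaf                = leaf
doubleᵗ (node leaf n)       = node tt (doubleᵗ n)
doubleᵗ (node (node _ _) n) = node tt (node leaf n)

predᵗ : Tree → Tree
predᵗ leaf                = leaf
predᵗ (node leaf n)       = doubleᵗ n
predᵗ (node (node _ _) n) = node leaf n

exponentᵗ : Tree → Tree
exponentᵗ leaf       = encodeℕᵇ exponent₀
exponentᵗ (node _ n) = doubleᵗ (doubleᵗ (exponentᵗ n))

-- Converts a binary numeral to unary but stops at the length of `u`, since the value of a numeral
-- can be exponential in its length.
cap : Tree → Tree → Tree
cap leaf       n             = leaf
cap (node _ u) leaf          = leaf
cap (node _ u) n@(node _ _)  = node leaf (cap u (predᵗ n))

infixr 6 _∪_

_∪_ : Tree → Tree → Tree
leaf     ∪ b          = b
node s t ∪ leaf       = node s t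
node s t ∪ node s′ t′ = node (s ∪ s′) (t ∪ t′)

tail : Tree → Tree
tail leaf       = leaf
tail (node _ t) = t

-- Lowering the first coordinate of all vectors by one discards the section at 0 and renumbers the
-- others, which is taking the tail of the list of sections.
dropIf : Tree → Tree → Tree
dropIf leaf       S = S
dropIf (node _ _) S = tail S

shift     : Tree → Tree → Tree
shiftEach : Tree → Tree → Tree

shift leaf       S = S
shift (node b l) S = shiftEach l (dropIf b S)

shiftEach l leaf       = leaf
shiftEach l (node s S) = node (shift l s) (shiftEach l S)

xorᵗ : Tree → Tree → Tree
xorᵗ leaf       b          = b
xorᵗ (node _ _) leaf       = tt
xorᵗ (node _ _) (node _ _) = leaf

xorEach : Tree → Tree → Tree → Tree
xorEach b leaf        l = l
xorEach b (node b′ c) l = node (xorᵗ b b′) (xorEach b c l)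

costs : Tree → Tree
costs leaf       = leaf
costs (node b c) = xorEach b c (costs c)

-- A leaf in place of a row is junk: process stops when the first row is exhausted,
-- and all rows have the same length.
step : Tree → Tree → Tree → Tree
step leaf                              c S = shift (costs c) S
step (node leaf rows)                  c S = S
step (node (node leaf _) rows)         c S =
  step rows (node leaf c) S ∪ step rows (node tt c) S
step (node (node (node b _) _) rows)   c S = step rows (node b c) S

tails : Tree → Tree
tails leaf            = leaf
tails (node row rows) = node (tail row) (tails rows)

check : Tree → Tree → Tree
check leaf       leaf       = leaf
check leaf       (node _ _) = tt
check (node _ l) leaf       = leaf
check (node _ l) (node s _) = check l s

process : Tree → Tree → Tree → Tree
-- Only the length of `costs rows` matters here: it tells `check` along how many coordinates to look
-- up zero.
process leaf       rows S = check (costs rows) S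
process (node _ u) rows S = process u (tails rows) (step rows leaf S)

repeat : Tree → Tree → Tree
repeat leaf       S = node S leaf
repeat (node _ r) S = node S (repeat r S)

wrap : Tree → Tree → Tree → Tree
wrap leaf       r S = S
wrap (node _ c) r S = repeat r (wrap c r S)

-- The coordinates are grouped as in `costs`: `wrap c` supplies the pairs of the first row with each
-- later one.
full : Tree → Tree → Tree
full leaf       r = tt
full (node _ c) r = wrap c r (full c r)

test : Tree → Tree → Tree
test leaf              r = tt
test rows@(node row _) r = process row rows (full rows r)

select : Tree → Tree → Tree → Tree → Tree
select leaf         M          rows r = test rows r
select (node _ _)   leaf       rows r = leaf
select k@(node _ k′) (node row M) rows r =
  caseTree (select k′ M (node row rows) r) (select k M rows r) (λ _ _ → tt)

-- Bounds on the number of calls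

len : Tree → ℕ
len leaf       = 0
len (node _ t) = suc (len t)

costsCalls : Tree → ℕ
costsCalls leaf       = 1
costsCalls (node _ c) = suc (costsCalls c + suc (len c))

wrapCalls fullCalls : Tree → Tree → ℕ
wrapCalls leaf       r = 1
wrapCalls (node _ c) r = suc (wrapCalls c r + suc (len r))
fullCalls leaf       r = 1
fullCalls (node _ c) r = suc (fullCalls c r + wrapCalls c r)

stepCalls : Tree → Tree → Tree → ℕ
stepCalls leaf                            c S = suc (costsCalls c + suc (2 * size S))
stepCalls (node leaf rows)                c S = 1
stepCalls (node (node leaf _) rows)       c S =
  suc (stepCalls rows (node leaf c) S + stepCalls rows (node tt c) S
       + size (step rows (node leaf c) S))
stepCalls (node (node (node b _) _) rows) c S = suc (stepCalls rows (node b c) S)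

processCalls : Tree → Tree → Tree → ℕ
processCalls leaf       rows S = suc (costsCalls rows + suc (len (costs rows)))
processCalls (node _ u) rows S =
  suc (suc (len rows) + stepCalls rows leaf S
       + processCalls u (tails rows) (step rows leaf S))

testCalls : Tree → Tree → ℕ
testCalls leaf              r = 1
testCalls rows@(node row _) r =
  suc (fullCalls rows r + processCalls row rows (full rows r))

-- Charges for both branches of the search, although the second is evaluated only if the first
-- fails.
selectCalls : Tree → Tree → Tree → Tree → ℕ
selectCalls leaf         M          rows r = suc (testCalls rows r)
selectCalls (node _ _)   leaf       rows r = 1
selectCalls k@(node _ k′) (node row M) rows r =
  suc (selectCalls k′ M (node row rows) r + selectCalls k M rows r)

exponentCalls : Tree → ℕ
exponentCalls leaf       = 1
exponentCalls (node _ n) =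
  suc (exponentCalls n + suc (len (exponentᵗ n)) + suc (len (doubleᵗ (exponentᵗ n))))

F : (f : Fin 18) → Vec Tree (lookup arities f) → Tree
F DOUBLE    (n ∷ [])                = doubleᵗ n
F PRED      (n ∷ [])                = predᵗ n
F EXPONENT  (n ∷ [])                = exponentᵗ n
F CAP       (u ∷ n ∷ [])            = cap u n
F UNION     (s ∷ t ∷ [])            = s ∪ t
F SHIFT     (l ∷ S ∷ [])            = shift l S
F SHIFTEACH (l ∷ S ∷ [])            = shiftEach l S
F XOREACH   (b ∷ c ∷ l ∷ [])        = xorEach b c l
F COSTS     (c ∷ [])                = costs c
F STEP      (rows ∷ c ∷ S ∷ [])     = step rows c S
F TAILS     (rows ∷ [])             = tails rows
F PROCESS   (u ∷ rows ∷ S ∷ [])     = process u rows S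
F REPEAT    (r ∷ S ∷ [])            = repeat r S
F WRAP      (c ∷ r ∷ S ∷ [])        = wrap c r S
F FULL      (c ∷ r ∷ [])            = full c r
F CHECK     (l ∷ S ∷ [])            = check l S
F TEST      (rows ∷ r ∷ [])         = test rows r
F SELECT    (k ∷ M ∷ rows ∷ r ∷ []) = select k M rows r

C : (f : Fin 18) → Vec Tree (lookup arities f) → ℕ
C DOUBLE    (n ∷ [])                = suc (len n)
C PRED      (n ∷ [])                = 2 + len n
C EXPONENT  (n ∷ [])                = exponentCalls n
C CAP       (u ∷ n ∷ [])            = suc (len u) * (3 + len n)
-- The recursion descends only where both tries have a node, so the size of one of them suffices.
C UNION     (s ∷ t ∷ [])            = size s
-- Each subtree is visited by at most one call of `SHIFT` and one of `SHIFTEACH`.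
C SHIFT     (l ∷ S ∷ [])            = suc (2 * size S)
C SHIFTEACH (l ∷ S ∷ [])            = 2 * size S
C XOREACH   (b ∷ c ∷ l ∷ [])        = suc (len c)
C COSTS     (c ∷ [])                = costsCalls c
C STEP      (rows ∷ c ∷ S ∷ [])     = stepCalls rows c S
C TAILS     (rows ∷ [])             = suc (len rows)
C PROCESS   (u ∷ rows ∷ S ∷ [])     = processCalls u rows S
C REPEAT    (r ∷ S ∷ [])            = suc (len r)
C WRAP      (c ∷ r ∷ S ∷ [])        = wrapCalls c r
C FULL      (c ∷ r ∷ [])            = fullCalls c r
C CHECK     (l ∷ S ∷ [])            = suc (len l)
C TEST      (rows ∷ r ∷ [])         = testCalls rows r
C SELECT    (k ∷ M ∷ rows ∷ r ∷ []) = selectCalls k M rows r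

open Denotation arities F C

-- The bodies agree with the intended values and call counts

F-correct : ∀ f vs → ⟦ bodies f ⟧ vs ≡ F f vs
F-correct DOUBLE (leaf ∷ [])                            = refl
F-correct DOUBLE (node leaf _ ∷ [])                     = refl
F-correct DOUBLE (node (node _ _) _ ∷ [])               = refl
F-correct PRED (leaf ∷ [])                              = refl
F-correct PRED (node leaf _ ∷ [])                       = refl
F-correct PRED (node (node _ _) _ ∷ [])                 = refl
F-correct EXPONENT (leaf ∷ [])                          = refl
F-correct EXPONENT (node _ _ ∷ [])                      = refl
F-correct CAP (leaf ∷ _ ∷ [])                           = refl
F-correct CAP (node _ _ ∷ leaf ∷ [])                    = refl
F-correct CAP (node _ _ ∷ node _ _ ∷ [])                = refl
F-correct UNION (leaf ∷ _ ∷ [])                         = refl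
F-correct UNION (node _ _ ∷ leaf ∷ [])                  = refl
F-correct UNION (node _ _ ∷ node _ _ ∷ [])              = refl
F-correct SHIFT (leaf ∷ _ ∷ [])                         = refl
F-correct SHIFT (node leaf _ ∷ _ ∷ [])                  = refl
F-correct SHIFT (node (node _ _) _ ∷ leaf ∷ [])         = refl
F-correct SHIFT (node (node _ _) _ ∷ node _ _ ∷ [])     = refl
F-correct SHIFTEACH (_ ∷ leaf ∷ [])                     = refl
F-correct SHIFTEACH (_ ∷ node _ _ ∷ [])                 = refl
F-correct XOREACH (_ ∷ leaf ∷ _ ∷ [])                   = refl
F-correct XOREACH (leaf ∷ node _ _ ∷ _ ∷ [])            = refl
F-correct XOREACH (node _ _ ∷ node leaf _ ∷ _ ∷ [])     = refl
F-correct XOREACH (node _ _ ∷ node (node _ _) _ ∷ _ ∷ []) = refl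
F-correct COSTS (leaf ∷ [])                             = refl
F-correct COSTS (node _ _ ∷ [])                         = refl
F-correct STEP (leaf ∷ _ ∷ _ ∷ [])                      = refl
F-correct STEP (node leaf _ ∷ _ ∷ _ ∷ [])               = refl
F-correct STEP (node (node leaf _) _ ∷ _ ∷ _ ∷ [])      = refl
F-correct STEP (node (node (node _ _) _) _ ∷ _ ∷ _ ∷ []) = refl
F-correct TAILS (leaf ∷ [])                             = refl
F-correct TAILS (node leaf _ ∷ [])                      = refl
F-correct TAILS (node (node _ _) _ ∷ [])                = refl
F-correct PROCESS (leaf ∷ _ ∷ _ ∷ [])                   = refl
F-correct PROCESS (node _ _ ∷ _ ∷ _ ∷ [])               = refl
F-correct REPEAT (leaf ∷ _ ∷ [])                        = refl
F-correct REPEAT (node _ _ ∷ _ ∷ [])                    = refl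
F-correct WRAP (leaf ∷ _ ∷ _ ∷ [])                      = refl
F-correct WRAP (node _ _ ∷ _ ∷ _ ∷ [])                  = refl
F-correct FULL (leaf ∷ _ ∷ [])                          = refl
F-correct FULL (node _ _ ∷ _ ∷ [])                      = refl
F-correct CHECK (leaf ∷ leaf ∷ [])                      = refl
F-correct CHECK (leaf ∷ node _ _ ∷ [])                  = refl
F-correct CHECK (node _ _ ∷ leaf ∷ [])                  = refl
F-correct CHECK (node _ _ ∷ node _ _ ∷ [])              = refl
F-correct TEST (leaf ∷ _ ∷ [])                          = refl
F-correct TEST (node _ _ ∷ _ ∷ [])                      = refl
F-correct SELECT (leaf ∷ _ ∷ _ ∷ _ ∷ [])                = refl
F-correct SELECT (node _ _ ∷ leaf ∷ _ ∷ _ ∷ [])         = refl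
F-correct SELECT (node _ _ ∷ node _ _ ∷ _ ∷ _ ∷ [])     = refl

len-doubleᵗ : ∀ n → len (doubleᵗ n) ≤ suc (len n)
len-doubleᵗ leaf                = z≤n
len-doubleᵗ (node leaf n)       = s≤s (len-doubleᵗ n)
len-doubleᵗ (node (node _ _) n) = ≤-refl

len-predᵗ : ∀ n → len (predᵗ n) ≤ len n
len-predᵗ leaf                = z≤n
len-predᵗ (node leaf n)       = len-doubleᵗ n
len-predᵗ (node (node _ _) n) = ≤-refl

size-tail : ∀ S → size (tail S) ≤ size S
size-tail leaf       = ≤-refl
size-tail (node s t) = m≤n⇒m≤1+n (m≤n+m (size t) (size s))

≤-by : ∀ {m n} d → m + d ≡ n → m ≤ n
≤-by d refl = m≤m+n _ d

exponent-arith-≡ : ∀ a b c → 1 + (a + 0 + suc b + 0 + suc c) ≡ 1 + (a + suc b + suc c)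
exponent-arith-≡ = solve-∀

exponent-arith : ∀ a b c → a + 0 + suc b + 0 + suc c < suc (a + suc b + suc c)
exponent-arith a b c = ≤-reflexive (exponent-arith-≡ a b c)

cap-arith-≡ : ∀ u n → 1 + (2 + n + 0 + suc u * (3 + n)) ≡ suc (suc u) * (3 + n)
cap-arith-≡ = solve-∀

cap-arith : ∀ u n → 2 + n + 0 + suc u * (3 + n) < suc (suc u) * (3 + n)
cap-arith u n = ≤-reflexive (cap-arith-≡ u n)

shifteach-arith-≡ : ∀ s S → 1 + (suc (2 * s) + 2 * S) ≡ 2 * suc (s + S)
shifteach-arith-≡ = solve-∀

shifteach-arith : ∀ s S → suc (2 * s) + 2 * S < 2 * suc (s + S)
shifteach-arith s S = ≤-reflexive (shifteach-arith-≡ s S)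

step-node-arith-≡ : ∀ a b d → 1 + (a + (b + 0) + d) ≡ 1 + (a + b + d)
step-node-arith-≡ = solve-∀

step-node-arith : ∀ a b d → a + (b + 0) + d < suc (a + b + d)
step-node-arith a b d = ≤-reflexive (step-node-arith-≡ a b d)

process-arith-≡ : ∀ a b c → 1 + (1 + (a + (b + 0) + c)) ≡ 1 + (suc a + b + c)
process-arith-≡ = solve-∀

process-arith : ∀ a b c → suc (a + (b + 0) + c) < suc (suc a + b + c)
process-arith a b c = ≤-reflexive (process-arith-≡ a b c)

drop-0-≡ : ∀ a b → 1 + (a + 0 + b) ≡ 1 + (a + b)
drop-0-≡ = solve-∀

drop-0 : ∀ a b → a + 0 + b < suc (a + b)
drop-0 a b = ≤-reflexive (drop-0-≡ a b)

C-correct : ∀ f vs → calls (bodies f) vs < C f vs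
C-correct DOUBLE (leaf ∷ [])                            = z<s
C-correct DOUBLE (node leaf _ ∷ [])                     = ≤-refl
C-correct DOUBLE (node (node _ _) _ ∷ [])               = z<s
C-correct PRED (leaf ∷ [])                              = z<s
C-correct PRED (node leaf n ∷ [])                       = n≤1+n _
C-correct PRED (node (node _ _) _ ∷ [])                 = z<s
C-correct EXPONENT (leaf ∷ [])                          = z<s
C-correct EXPONENT (node _ n ∷ [])                      =
  exponent-arith (exponentCalls n) (len (exponentᵗ n)) (len (doubleᵗ (exponentᵗ n)))
C-correct CAP (leaf ∷ _ ∷ [])                           = z<s
C-correct CAP (node _ _ ∷ leaf ∷ [])                    = z<s
C-correct CAP (node _ u ∷ n@(node _ m) ∷ [])            = ≤-<-trans
  (+-monoʳ-≤ (2 + len n + 0) (*-monoʳ-≤ (suc (len u)) (+-monoʳ-≤ 3 (len-predᵗ n))))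
  (cap-arith (len u) (len n))
C-correct UNION (leaf ∷ _ ∷ [])                         = z<s
C-correct UNION (node _ _ ∷ leaf ∷ [])                  = z<s
C-correct UNION (node _ _ ∷ node _ _ ∷ [])              = ≤-refl
C-correct SHIFT (leaf ∷ _ ∷ [])                         = z<s
C-correct SHIFT (node leaf _ ∷ _ ∷ [])                  = ≤-refl
C-correct SHIFT (node (node _ _) _ ∷ leaf ∷ [])         = ≤-refl
C-correct SHIFT (node (node _ _) _ ∷ S@(node _ _) ∷ []) = s≤s (*-monoʳ-≤ 2 (size-tail S))
C-correct SHIFTEACH (_ ∷ leaf ∷ [])                     = z<s
C-correct SHIFTEACH (_ ∷ node s S ∷ [])                 = shifteach-arith (size s) (size S)
C-correct XOREACH (_ ∷ leaf ∷ _ ∷ [])                   = z<s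
C-correct XOREACH (leaf ∷ node _ _ ∷ _ ∷ [])            = ≤-refl
C-correct XOREACH (node _ _ ∷ node leaf _ ∷ _ ∷ [])     = ≤-refl
C-correct XOREACH (node _ _ ∷ node (node _ _) _ ∷ _ ∷ []) = ≤-refl
C-correct COSTS (leaf ∷ [])                             = z<s
C-correct COSTS (node _ c ∷ [])                         = drop-0 (costsCalls c) (suc (len c))
C-correct STEP (leaf ∷ c ∷ S ∷ [])                      =
  drop-0 (costsCalls c) (suc (2 * size S))
C-correct STEP (node leaf _ ∷ _ ∷ _ ∷ [])               = z<s
C-correct STEP (node (node leaf _) rows ∷ c ∷ S ∷ [])   =
  step-node-arith (stepCalls rows (node leaf c) S) (stepCalls rows (node tt c) S)
         (size (step rows (node leaf c) S))
C-correct STEP (node (node (node _ _) _) _ ∷ _ ∷ _ ∷ []) = ≤-refl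
C-correct TAILS (leaf ∷ [])                             = z<s
C-correct TAILS (node leaf _ ∷ [])                      = ≤-refl
C-correct TAILS (node (node _ _) _ ∷ [])                = ≤-refl
C-correct PROCESS (leaf ∷ rows ∷ _ ∷ [])                =
  drop-0 (costsCalls rows) (suc (len (costs rows)))
C-correct PROCESS (node _ u ∷ rows ∷ S ∷ [])            =
  process-arith (len rows) (stepCalls rows leaf S)
         (processCalls u (tails rows) (step rows leaf S))
C-correct REPEAT (leaf ∷ _ ∷ [])                        = z<s
C-correct REPEAT (node _ _ ∷ _ ∷ [])                    = ≤-refl
C-correct WRAP (leaf ∷ _ ∷ _ ∷ [])                      = z<s
C-correct WRAP (node _ c ∷ r ∷ _ ∷ [])                  = drop-0 (wrapCalls c r) (suc (len r))
C-correct FULL (leaf ∷ _ ∷ [])                          = z<s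
C-correct FULL (node _ c ∷ r ∷ [])                      = drop-0 (fullCalls c r) (wrapCalls c r)
C-correct CHECK (leaf ∷ leaf ∷ [])                      = z<s
C-correct CHECK (leaf ∷ node _ _ ∷ [])                  = z<s
C-correct CHECK (node _ _ ∷ leaf ∷ [])                  = z<s
C-correct CHECK (node _ _ ∷ node _ _ ∷ [])              = ≤-refl
C-correct TEST (leaf ∷ _ ∷ [])                          = z<s
C-correct TEST (rows@(node row rest) ∷ r ∷ [])          =
  drop-0 (fullCalls rows r) (processCalls row rows (full rows r))
C-correct SELECT (leaf ∷ _ ∷ _ ∷ _ ∷ [])                = ≤-refl
C-correct SELECT (node _ _ ∷ leaf ∷ _ ∷ _ ∷ [])         = z<s
C-correct SELECT (k@(node _ k′) ∷ node row M ∷ rows ∷ r ∷ [])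
  with select k′ M (node row rows) r
... | leaf     = ≤-refl
... | node _ _ = s≤s (+-monoʳ-≤ (selectCalls k′ M (node row rows) r) z≤n)

bodies≤60 : ∀ f → ∣ bodies f ∣ᵉ ≤ 60
bodies≤60 = from-yes (all? {n = 18} λ f → ∣ bodies f ∣ᵉ ≤? 60)

-- Decisions and sets stored as tries

data Answers (P : Set) : Tree → Set where
  yes : P → Answers P tt
  no  : ¬ P → Answers P leaf

answers-map : ∀ {P Q t} → (P → Q) → (Q → P) → Answers P t → Answers Q t
answers-map f g (yes p) = yes (f p)
answers-map f g (no ¬p) = no (¬p ∘ g)

answers-or : ∀ {P Q s t} → Answers P s → Answers Q t →
             Answers (P ⊎ Q) (caseTree s t (λ _ _ → tt))
answers-or (yes p) _       = yes (inj₁ p)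
answers-or (no ¬p) (yes q) = yes (inj₂ q)
answers-or (no ¬p) (no ¬q) = no [ ¬p , ¬q ]′

-- A set of vectors of natural numbers is stored as a trie: the list of its
-- sections by the first coordinate; leaf is empty in every dimension.
infix 4 _∈ᵗ_

_∈ᵗ_ : List ℕ → Tree → Set
_           ∈ᵗ leaf     = ⊥
[]          ∈ᵗ node _ _ = ⊤
(zero  ∷ v) ∈ᵗ node s _ = v ∈ᵗ s
(suc n ∷ v) ∈ᵗ node _ S = n ∷ v ∈ᵗ S

∪⁺ : ∀ v S T → v ∈ᵗ S ⊎ v ∈ᵗ T → v ∈ᵗ S ∪ T
∪⁺ v           leaf       T            (inj₂ v∈) = v∈
∪⁺ v           (node _ _) leaf         (inj₁ v∈) = v∈
∪⁺ []          (node _ _) (node _ _)   _         = _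
∪⁺ (zero  ∷ v) (node s _) (node s′ _)  v∈        = ∪⁺ v s s′ v∈
∪⁺ (suc n ∷ v) (node _ S) (node _ S′)  v∈        = ∪⁺ (n ∷ v) S S′ v∈

∪⁻ : ∀ v S T → v ∈ᵗ S ∪ T → v ∈ᵗ S ⊎ v ∈ᵗ T
∪⁻ v           leaf       T            v∈ = inj₂ v∈
∪⁻ v           (node _ _) leaf         v∈ = inj₁ v∈
∪⁻ []          (node _ _) (node _ _)   _  = inj₁ _
∪⁻ (zero  ∷ v) (node s _) (node s′ _)  v∈ = ∪⁻ v s s′ v∈
∪⁻ (suc n ∷ v) (node _ S) (node _ S′)  v∈ = ∪⁻ (n ∷ v) S S′ v∈

bits : List Bool → Tree
bits = encodeList encodeBool

addBit : Bool → ℕ → ℕ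
addBit false n = n
addBit true  n = suc n

addBits : List Bool → List ℕ → List ℕ
addBits []      v       = v
addBits (_ ∷ _) []      = []
addBits (b ∷ l) (n ∷ v) = addBit b n ∷ addBits l v

-- Shifting subtracts the bits, so membership after it means membership of the sum before it. Both
-- sides reduce to the same type along the trie, hence an equation between types instead of two
-- implications.
∈-shift : ∀ l v S → length l ≡ length v →
          (v ∈ᵗ shift (bits l) S) ≡ (addBits l v ∈ᵗ S)
∈-shiftEach : ∀ l n v S → length l ≡ length v →
              (n ∷ v ∈ᵗ shiftEach (bits l) S) ≡ (n ∷ addBits l v ∈ᵗ S)

∈-shift []          v       S          _  = refl
∈-shift (false ∷ l) (n ∷ v) S          eq = ∈-shiftEach l n v S (suc-injective eq)
∈-shift (true  ∷ l) (n ∷ v) leaf       eq = refl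
∈-shift (true  ∷ l) (n ∷ v) (node _ S) eq = ∈-shiftEach l n v S (suc-injective eq)

∈-shiftEach l n       v leaf       eq = refl
∈-shiftEach l zero    v (node s _) eq = ∈-shift l v s eq
∈-shiftEach l (suc n) v (node _ S) eq = ∈-shiftEach l n v S eq

check-answers : ∀ l {v} S → length l ≡ length v → All (_≡ 0) v →
                Answers (v ∈ᵗ S) (check (bits l) S)
check-answers []      leaf       _  []          = no id
check-answers []      (node _ _) _  []          = yes _
check-answers (_ ∷ l) leaf       _  (_ ∷ _)     = no id
check-answers (_ ∷ l) (node s _) eq (refl ∷ v≡0) = check-answers l s (suc-injective eq) v≡0

∈-repeat⁺ : ∀ r n v S → n ≤ len r → v ∈ᵗ S → n ∷ v ∈ᵗ repeat r S
∈-repeat⁺ leaf       zero    v S _         v∈ = v∈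
∈-repeat⁺ (node _ r) zero    v S _         v∈ = v∈
∈-repeat⁺ (node _ r) (suc n) v S (s≤s n≤r) v∈ = ∈-repeat⁺ r n v S n≤r v∈

∈-repeat⁻ : ∀ r n v S → n ∷ v ∈ᵗ repeat r S → n ≤ len r × v ∈ᵗ S
∈-repeat⁻ leaf       zero    v S v∈ = z≤n , v∈
∈-repeat⁻ (node _ r) zero    v S v∈ = z≤n , v∈
∈-repeat⁻ (node _ r) (suc n) v S v∈ = map₁ s≤s (∈-repeat⁻ r n v S v∈)

∈-wrap⁺ : ∀ c r v w S → length v ≡ len c → All (_≤ len r) v → w ∈ᵗ S →
          v ++ w ∈ᵗ wrap c r S
∈-wrap⁺ leaf       r []      w S _  []          w∈ = w∈
∈-wrap⁺ (node _ c) r (n ∷ v) w S eq (n≤r ∷ v≤r) w∈ =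
  ∈-repeat⁺ r n (v ++ w) _ n≤r (∈-wrap⁺ c r v w S (suc-injective eq) v≤r w∈)

∈-wrap⁻ : ∀ c r v w S → length v ≡ len c → v ++ w ∈ᵗ wrap c r S →
          All (_≤ len r) v × w ∈ᵗ S
∈-wrap⁻ leaf       r []      w S _  w∈ = [] , w∈
∈-wrap⁻ (node _ c) r (n ∷ v) w S eq v∈
  with n≤r , v∈′ ← ∈-repeat⁻ r n (v ++ w) _ v∈
  with v≤r , w∈ ← ∈-wrap⁻ c r v w S (suc-injective eq) v∈′
  = n≤r ∷ v≤r , w∈

-- Pairwise distances and the cost of a column

hamming : ∀ {d} → Vec Bool d → Vec Bool d → ℕ
hamming []      []      = 0
hamming (x ∷ p) (y ∷ q) = addBit (x xor y) (hamming p q)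

distances : ∀ {d} → List (Vec Bool d) → List ℕ
distances []       = []
distances (p ∷ ps) = map (hamming p) ps ++ distances ps

∈-full⁺ : ∀ {d} c r (ps : List (Vec Bool d)) → length ps ≡ len c →
          All (_≤ len r) (distances ps) → distances ps ∈ᵗ full c r
∈-full⁺ leaf       r []       _  _  = _
∈-full⁺ (node _ c) r (p ∷ ps) eq ≤r =
  ∈-wrap⁺ c r (map (hamming p) ps) (distances ps) (full c r)
    (trans (length-map _ ps) (suc-injective eq)) (All.++⁻ˡ _ ≤r)
    (∈-full⁺ c r ps (suc-injective eq) (All.++⁻ʳ (map (hamming p) ps) ≤r))

∈-full⁻ : ∀ {d} c r (ps : List (Vec Bool d)) → length ps ≡ len c →
          distances ps ∈ᵗ full c r → All (_≤ len r) (distances ps)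
∈-full⁻ leaf       r []       _  _  = []
∈-full⁻ (node _ c) r (p ∷ ps) eq ∈full
  with p≤r , ∈full′ ← ∈-wrap⁻ c r (map (hamming p) ps) (distances ps) (full c r)
                        (trans (length-map _ ps) (suc-injective eq)) ∈full
  = All.++⁺ p≤r (∈-full⁻ c r ps (suc-injective eq) ∈full′)

xor-encode : ∀ a b → xorᵗ (encodeBool a) (encodeBool b) ≡ encodeBool (a xor b)
xor-encode false b     = refl
xor-encode true  false = refl
xor-encode true  true  = refl

columnCosts : List Bool → List Bool
columnCosts []      = []
columnCosts (b ∷ c) = map (b xor_) c ++ columnCosts c

costs-encode : ∀ c → costs (bits c) ≡ bits (columnCosts c)
costs-encode []      = refl
costs-encode (b ∷ c) = trans (cong (xorEach (encodeBool b) (bits c)) (costs-encode c)) (lemma c)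
  where
  lemma : ∀ c {l} → xorEach (encodeBool b) (bits c) (bits l) ≡ bits (map (b xor_) c ++ l)
  lemma []       = refl
  lemma (b′ ∷ c) = cong₂ node (xor-encode b b′) (lemma c)

length-columnCosts : ∀ {d} c (ps : List (Vec Bool d)) → length c ≡ length ps →
                     length (columnCosts c) ≡ length (distances ps)
length-columnCosts []      []       _  = refl
length-columnCosts (b ∷ c) (p ∷ ps) eq = begin
  length (map (b xor_) c ++ columnCosts c)        ≡⟨ length-++ (map (b xor_) c) ⟩
  length (map (b xor_) c) + length (columnCosts c)
    ≡⟨ cong₂ _+_ (trans (length-map _ c) (trans (suc-injective eq) (sym (length-map _ ps))))
                 (length-columnCosts c ps (suc-injective eq)) ⟩
  length (map (hamming p) ps) + length (distances ps) ≡⟨ length-++ (map (hamming p) ps) ⟨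
  length (map (hamming p) ps ++ distances ps)     ∎
  where open ≡-Reasoning

-- Hamming distance is additive over coordinates, and `columnCosts` lists the pairs in the order of
-- `distances`. This is what makes the treatment column by column correct.
distances-∷ : ∀ {d} (ps : List (Vec Bool (suc d))) →
  distances ps ≡ addBits (columnCosts (map Vec.head ps)) (distances (map Vec.tail ps))
distances-∷ []                 = refl
distances-∷ (p@(x ∷ p′) ∷ ps) = trans (cong (map (hamming p) ps ++_) (distances-∷ ps)) (lemma ps)
  where
  lemma : ∀ qs {l v} →
    map (hamming p) qs ++ addBits l v ≡
    addBits (map (x xor_) (map Vec.head qs) ++ l) (map (hamming p′) (map Vec.tail qs) ++ v)
  lemma []             = refl
  lemma ((_ ∷ _) ∷ qs) = cong (_ ∷_) (lemma qs)

-- Completions, one column at a time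

Fits : Entry → Bool → Set
Fits e b = e ≡ □ ⊎ just b ≡ e

Completes : ∀ {d} → Vec Entry d → Vec Bool d → Set
Completes a p = ∀ i → Fits (Vec.lookup a i) (Vec.lookup p i)

HeadFits : ∀ {d} → Vec Entry (suc d) → Bool → Set
HeadFits a b = Fits (Vec.head a) b

matrix : ∀ {d} → List (Vec Entry d) → Tree
matrix = encodeList encodeVector

module _ {d} (qs : List (Vec Bool d)) where

  -- Here `qs` is any completion of the remaining columns; only its distances and its number of rows
  -- enter, so the current column is completed independently of it. Entries are pushed onto the
  -- accumulator `c`, which gives `bs ʳ++ c`.
  step⁻ : ∀ (rows : List (Vec Entry (suc d))) c S → length rows + length c ≡ length qs →
    distances qs ∈ᵗ step (matrix rows) (bits c) S →
    ∃[ bs ] Pointwise HeadFits rows bs ×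
            addBits (columnCosts (bs ʳ++ c)) (distances qs) ∈ᵗ S
  step⁻ [] c S eq ∈step = [] , [] ,
    subst id (∈-shift (columnCosts c) _ S (length-columnCosts c qs eq))
      (subst (λ l → distances qs ∈ᵗ shift l S) (costs-encode c) ∈step)
  step⁻ ((just b ∷ a) ∷ rows) c S eq ∈step =
    let bs , fits , ∈S = step⁻ rows (b ∷ c) S (trans (+-suc _ _) eq) ∈step
    in b ∷ bs , inj₂ refl ∷ fits , ∈S
  step⁻ ((□ ∷ a) ∷ rows) c S eq ∈step
    with ∪⁻ (distances qs) (step (matrix rows) (bits (false ∷ c)) S) _ ∈step
  ... | inj₁ ∈step =
    let bs , fits , ∈S = step⁻ rows (false ∷ c) S (trans (+-suc _ _) eq) ∈step
    in false ∷ bs , inj₁ refl ∷ fits , ∈S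
  ... | inj₂ ∈step =
    let bs , fits , ∈S = step⁻ rows (true ∷ c) S (trans (+-suc _ _) eq) ∈step
    in true ∷ bs , inj₁ refl ∷ fits , ∈S

  step⁺ : ∀ {rows : List (Vec Entry (suc d))} {bs} c S → length rows + length c ≡ length qs → Pointwise HeadFits rows bs →
    addBits (columnCosts (bs ʳ++ c)) (distances qs) ∈ᵗ S →
    distances qs ∈ᵗ step (matrix rows) (bits c) S
  step⁺ c S eq [] ∈S =
    subst (λ l → distances qs ∈ᵗ shift l S) (sym (costs-encode c))
      (subst id (sym (∈-shift (columnCosts c) _ S (length-columnCosts c qs eq))) ∈S)
  step⁺ {(just b ∷ a) ∷ rows} c S eq (inj₂ refl ∷ fits) ∈S =
    step⁺ (b ∷ c) S (trans (+-suc _ _) eq) fits ∈S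
  step⁺ {(□ ∷ a) ∷ rows} {false ∷ bs} c S eq (_ ∷ fits) ∈S =
    ∪⁺ (distances qs) (step (matrix rows) (bits (false ∷ c)) S) _
      (inj₁ (step⁺ (false ∷ c) S (trans (+-suc _ _) eq) fits ∈S))
  step⁺ {(□ ∷ a) ∷ rows} {true ∷ bs} c S eq (_ ∷ fits) ∈S =
    ∪⁺ (distances qs) (step (matrix rows) (bits (false ∷ c)) S) _
      (inj₂ (step⁺ (true ∷ c) S (trans (+-suc _ _) eq) fits ∈S))

tails-matrix : ∀ {d} (rows : List (Vec Entry (suc d))) →
               tails (matrix rows) ≡ matrix (map Vec.tail rows)
tails-matrix []               = refl
tails-matrix ((_ ∷ _) ∷ rows) = cong (node _) (tails-matrix rows)

-- An exhausted row is encoded as `leaf`, which is also the encoding of `false`. So the results on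
-- bit lists apply to a matrix without columns.
matrix₀ : (rows : List (Vec Entry 0)) → matrix rows ≡ bits (map (λ _ → false) rows)
matrix₀ []          = refl
matrix₀ ([] ∷ rows) = cong (node leaf) (matrix₀ rows)

distances₀ : (ps : List (Vec Bool 0)) → All (_≡ 0) (distances ps)
distances₀ []        = []
distances₀ ([] ∷ ps) = All.++⁺ (All.map⁺ (All.universal (λ { [] → refl }) ps)) (distances₀ ps)

completion₀-unique : ∀ {rows : List (Vec Entry 0)} {ps} → Pointwise Completes rows ps →
                     ps ≡ map (λ _ → []) rows
completion₀-unique []                  = refl
completion₀-unique (_∷_ {y = []} _ pw) = cong ([] ∷_) (completion₀-unique pw)

completion₀ : (rows : List (Vec Entry 0)) → Pointwise Completes rows (map (λ _ → []) rows)
completion₀ []         = []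
completion₀ (_ ∷ rows) = (λ ()) ∷ completion₀ rows

prependColumn : ∀ {d} {rows : List (Vec Entry (suc d))} {bs ps} →
  Pointwise HeadFits rows bs → Pointwise Completes (map Vec.tail rows) ps →
  ∃[ qs ] Pointwise Completes rows qs × map Vec.head qs ≡ bs × map Vec.tail qs ≡ ps
prependColumn {rows = []} [] [] = [] , [] , refl , refl
prependColumn {rows = (_ ∷ _) ∷ _} (_∷_ {y = b} e fits) (_∷_ {y = p} a completes)
  with qs , pw , heads , tails ← prependColumn fits completes
  = (b ∷ p) ∷ qs , (λ { zero → e ; (suc i) → a i }) ∷ pw , cong (b ∷_) heads , cong (p ∷_) tails

heads-fit : ∀ {d} {rows : List (Vec Entry (suc d))} {ps} → Pointwise Completes rows ps →
            Pointwise HeadFits rows (map Vec.head ps)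
heads-fit {rows = []}          []       = []
heads-fit {rows = (_ ∷ _) ∷ _} (_∷_ {y = _ ∷ _} a pw) = a zero ∷ heads-fit pw

tails-complete : ∀ {d} {rows : List (Vec Entry (suc d))} {ps} → Pointwise Completes rows ps →
                 Pointwise Completes (map Vec.tail rows) (map Vec.tail ps)
tails-complete {rows = []}          []       = []
tails-complete {rows = (_ ∷ _) ∷ _} (_∷_ {y = _ ∷ _} a pw) = a ∘ suc ∷ tails-complete pw

-- step collects the entries of a column in reverse order.
process-answers : ∀ {d} (u : Vec Entry d) (rows : List (Vec Entry d)) S →
  Answers (∃[ ps ] Pointwise Completes rows ps × distances (reverse ps) ∈ᵗ S)
          (process (encodeVector u) (matrix rows) S)
process-answers [] rows S rewrite matrix₀ rows | costs-encode (map (λ _ → false) rows) =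
  answers-map (λ ∈S → ps₀ , completion₀ rows , ∈S)
    (λ { (ps , pw , ∈S) → subst (λ ps → distances (reverse ps) ∈ᵗ S) (completion₀-unique pw) ∈S })
    (check-answers (columnCosts bs₀) S
      (length-columnCosts bs₀ (reverse ps₀)
        (trans (length-map _ rows) (sym (trans (length-reverse ps₀) (length-map _ rows)))))
      (distances₀ (reverse ps₀)))
  where
  bs₀ = map (λ _ → false) rows

  ps₀ : List (Vec Bool 0)
  ps₀ = map (λ _ → []) rows
process-answers (_ ∷ u) rows S rewrite tails-matrix rows =
  answers-map forward backward
    (process-answers u (map Vec.tail rows) (step (matrix rows) leaf S))
  where
  distances-reverse : ∀ ps → distances (reverse ps) ≡
    addBits (columnCosts (reverse (map Vec.head ps))) (distances (reverse (map Vec.tail ps)))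
  distances-reverse ps = trans (distances-∷ (reverse ps))
    (cong₂ (λ bs ps′ → addBits (columnCosts bs) (distances ps′)) (map-ʳ++ Vec.head ps) (map-ʳ++ Vec.tail ps))

  lengths : ∀ {ps} → Pointwise Completes (map Vec.tail rows) ps → length rows + 0 ≡ length (reverse ps)
  lengths {ps} pw = trans (+-identityʳ _) (trans (sym (length-map _ rows))
    (trans (Pointwise-length pw) (sym (length-reverse ps))))

  forward : (∃[ ps ] Pointwise Completes (map Vec.tail rows) ps × distances (reverse ps) ∈ᵗ step (matrix rows) leaf S) →
            ∃[ ps ] Pointwise Completes rows ps × distances (reverse ps) ∈ᵗ S
  forward (ps′ , pw′ , ∈step)
    with bs , fits , ∈S ← step⁻ (reverse ps′) rows [] S (lengths pw′) ∈step
    with ps , pw , refl , refl ← prependColumn fits pw′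
    = ps , pw , subst (_∈ᵗ S) (sym (distances-reverse ps)) ∈S

  backward : (∃[ ps ] Pointwise Completes rows ps × distances (reverse ps) ∈ᵗ S) →
             ∃[ ps ] Pointwise Completes (map Vec.tail rows) ps × distances (reverse ps) ∈ᵗ step (matrix rows) leaf S
  backward (ps , pw , ∈S) = map Vec.tail ps , tails-complete pw ,
    step⁺ (reverse (map Vec.tail ps)) [] S (lengths (tails-complete pw)) (heads-fit pw)
      (subst (_∈ᵗ S) (distances-reverse ps) ∈S)

-- Clusters in terms of pairwise distances

Close : ∀ {d} → ℕ → List (Vec Bool d) → Set
Close ρ ps = ∀ {p q} → p ∈ ps → q ∈ ps → hamming p q ≤ ρ

hamming-refl : ∀ {d} (p : Vec Bool d) → hamming p p ≡ 0
hamming-refl []          = refl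
hamming-refl (false ∷ p) = hamming-refl p
hamming-refl (true  ∷ p) = hamming-refl p

hamming-sym : ∀ {d} (p q : Vec Bool d) → hamming p q ≡ hamming q p
hamming-sym []          []          = refl
hamming-sym (false ∷ p) (false ∷ q) = hamming-sym p q
hamming-sym (false ∷ p) (true  ∷ q) = cong suc (hamming-sym p q)
hamming-sym (true  ∷ p) (false ∷ q) = cong suc (hamming-sym p q)
hamming-sym (true  ∷ p) (true  ∷ q) = hamming-sym p q

close⇒distances : ∀ {d ρ} (ps : List (Vec Bool d)) → Close ρ ps → All (_≤ ρ) (distances ps)
close⇒distances []       close = []
close⇒distances (p ∷ ps) close =
  All.++⁺ (All.map⁺ (All.tabulate (close (here refl) ∘ there)))
          (close⇒distances ps λ p∈ q∈ → close (there p∈) (there q∈))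

-- `distances` has each unordered pair of positions once; `hamming-refl` supplies the diagonal and
-- `hamming-sym` the opposite order.
distances⇒close : ∀ {d ρ} (ps : List (Vec Bool d)) → All (_≤ ρ) (distances ps) → Close ρ ps
distances⇒close {ρ = ρ} (p ∷ ps) ≤ρ (here refl) (here refl) = subst (_≤ ρ) (sym (hamming-refl p)) z≤n
distances⇒close (p ∷ ps) ≤ρ (here refl) (there q∈) =
  All.lookup (All.map⁻ (All.++⁻ˡ (map (hamming p) ps) ≤ρ)) q∈
distances⇒close {ρ = ρ} (q ∷ ps) ≤ρ {p} (there p∈) (here refl) = subst (_≤ ρ) (hamming-sym q p)
  (All.lookup (All.map⁻ (All.++⁻ˡ (map (hamming q) ps) ≤ρ)) p∈)
distances⇒close (p ∷ ps) ≤ρ (there p∈) (there q∈) =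
  distances⇒close ps (All.++⁻ʳ (map (hamming p) ps) ≤ρ) p∈ q∈

Close-↭ : ∀ {d ρ} {ps qs : List (Vec Bool d)} → ps ↭ qs → Close ρ ps → Close ρ qs
Close-↭ ps↭qs close p∈ q∈ = close (∈-resp-↭ (↭-sym ps↭qs) p∈) (∈-resp-↭ (↭-sym ps↭qs) q∈)

Completable : ∀ {d} → ℕ → List (Vec Entry d) → Set
Completable ρ rows = ∃[ ps ] Pointwise Completes rows ps × Close ρ ps

len-matrix : ∀ {d} (rows : List (Vec Entry d)) → len (matrix rows) ≡ length rows
len-matrix []         = refl
len-matrix (_ ∷ rows) = cong suc (len-matrix rows)

-- Membership in the full box says that all pairwise distances are at most `len r`. The reversal
-- made by `process` is harmless because closeness is invariant under permutation.
test-answers : ∀ {d} (rows : List (Vec Entry d)) r →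
               Answers (Completable (len r) rows) (test (matrix rows) r)
test-answers []              r = yes ([] , [] , λ ())
test-answers rows@(row ∷ _) r =
  answers-map
    (λ (ps , pw , ∈full) → ps , pw ,
      Close-↭ (↭-reverse ps)
        (distances⇒close (reverse ps) (∈-full⁻ (matrix rows) r (reverse ps) (lengths pw) ∈full)))
    (λ (ps , pw , close) → ps , pw ,
      ∈-full⁺ (matrix rows) r (reverse ps) (lengths pw)
        (close⇒distances (reverse ps) (Close-↭ (↭-sym (↭-reverse ps)) close)))
    (process-answers row rows (full (matrix rows) r))
  where
  lengths : ∀ {ps} → Pointwise Completes rows ps → length (reverse ps) ≡ len (matrix rows)
  lengths {ps} pw =
    trans (length-reverse ps) (trans (sym (Pointwise-length pw)) (sym (len-matrix rows)))

-- Sub-multisets as ordered selections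

module _ {A : Set} where

  right-all : (M : List A) → Interleaving [] M M
  right-all []      = []
  right-all (_ ∷ M) = consʳ (right-all M)

  left-++-right : (X Y : List A) → Interleaving X Y (X ++ Y)
  left-++-right []      Y = right-all Y
  left-++-right (_ ∷ X) Y = consˡ (left-++-right X Y)

  -- A sub-multiset is known only up to permutation, whereas `select` enumerates choices in the
  -- order of the list. Carrying a splitting along a permutation changes the chosen part only by a
  -- permutation.
  interleaving-↭ : ∀ {X Y M N : List A} → Interleaving X Y M → M ↭ N →
                   ∃[ X′ ] ∃[ Y′ ] Interleaving X′ Y′ N × X ↭ X′
  interleaving-↭ sp         ↭.refl       = _ , _ , sp , ↭-refl
  interleaving-↭ (consˡ sp) (prep x π)   =
    let _ , _ , sp′ , σ = interleaving-↭ sp π in _ , _ , consˡ sp′ , prep x σ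
  interleaving-↭ (consʳ sp) (prep x π)   =
    let _ , _ , sp′ , σ = interleaving-↭ sp π in _ , _ , consʳ sp′ , σ
  interleaving-↭ (consˡ (consˡ sp)) (swap x y π) =
    let _ , _ , sp′ , σ = interleaving-↭ sp π in _ , _ , consˡ (consˡ sp′) , swap x y σ
  interleaving-↭ (consˡ (consʳ sp)) (swap x y π) =
    let _ , _ , sp′ , σ = interleaving-↭ sp π in _ , _ , consʳ (consˡ sp′) , prep x σ
  interleaving-↭ (consʳ (consˡ sp)) (swap x y π) =
    let _ , _ , sp′ , σ = interleaving-↭ sp π in _ , _ , consˡ (consʳ sp′) , prep y σ
  interleaving-↭ (consʳ (consʳ sp)) (swap x y π) =
    let _ , _ , sp′ , σ = interleaving-↭ sp π in _ , _ , consʳ (consʳ sp′) , σ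
  interleaving-↭ sp (↭.trans π π′) =
    let _ , _ , sp′ , σ  = interleaving-↭ sp π
        _ , _ , sp″ , σ′ = interleaving-↭ sp′ π′
    in _ , _ , sp″ , ↭-trans σ σ′

module _ {A B : Set} {R : A → B → Set} where

  pointwise-↭ʳ : ∀ {xs ys zs} → Pointwise R xs ys → ys ↭ zs →
                 ∃[ ws ] xs ↭ ws × Pointwise R ws zs
  pointwise-↭ʳ pw           ↭.refl       = _ , ↭-refl , pw
  pointwise-↭ʳ (r ∷ pw)     (prep _ π)   =
    let _ , σ , pw′ = pointwise-↭ʳ pw π in _ , prep _ σ , r ∷ pw′
  pointwise-↭ʳ (r ∷ s ∷ pw) (swap _ _ π) =
    let _ , σ , pw′ = pointwise-↭ʳ pw π in _ , swap _ _ σ , s ∷ r ∷ pw′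
  pointwise-↭ʳ pw           (↭.trans π π′) =
    let _ , σ , pw′  = pointwise-↭ʳ pw π
        _ , σ′ , pw″ = pointwise-↭ʳ pw′ π′
    in _ , ↭-trans σ σ′ , pw″

  pointwise-↭ˡ : ∀ {xs ys ws} → Pointwise R xs ys → xs ↭ ws →
                 ∃[ zs ] ys ↭ zs × Pointwise R ws zs
  pointwise-↭ˡ pw           ↭.refl       = _ , ↭-refl , pw
  pointwise-↭ˡ (r ∷ pw)     (prep _ π)   =
    let _ , σ , pw′ = pointwise-↭ˡ pw π in _ , prep _ σ , r ∷ pw′
  pointwise-↭ˡ (r ∷ s ∷ pw) (swap _ _ π) =
    let _ , σ , pw′ = pointwise-↭ˡ pw π in _ , swap _ _ σ , s ∷ r ∷ pw′
  pointwise-↭ˡ pw           (↭.trans π π′) =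
    let _ , σ , pw′  = pointwise-↭ˡ pw π
        _ , σ′ , pw″ = pointwise-↭ˡ pw′ π′
    in _ , ↭-trans σ σ′ , pw″

  pointwise-++ʳ : ∀ {xs} ys {zs} → Pointwise R xs (ys ++ zs) →
                  ∃[ us ] ∃[ vs ] xs ≡ us ++ vs × Pointwise R us ys
  pointwise-++ʳ []       pw       = _ , _ , refl , []
  pointwise-++ʳ (_ ∷ ys) (r ∷ pw) with us , vs , refl , pw′ ← pointwise-++ʳ ys pw
    = _ ∷ us , vs , refl , r ∷ pw′

  pointwise-interleave : ∀ {X Y M us vs} → Interleaving X Y M → Pointwise R X us → Pointwise R Y vs →
                         ∃[ N ] Interleaving us vs N × Pointwise R M N
  pointwise-interleave []         []       []       = [] , [] , []
  pointwise-interleave (consˡ sp) (r ∷ pw) pw′      =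
    let N , sp′ , pw″ = pointwise-interleave sp pw pw′ in _ ∷ N , consˡ sp′ , r ∷ pw″
  pointwise-interleave (consʳ sp) pw       (r ∷ pw′) =
    let N , sp′ , pw″ = pointwise-interleave sp pw pw′ in _ ∷ N , consʳ sp′ , r ∷ pw″

completable-↭ : ∀ {d ρ} {X Y : List (Vec Entry d)} → X ↭ Y → Completable ρ X → Completable ρ Y
completable-↭ π (ps , pw , close) =
  let qs , σ , pw′ = pointwise-↭ˡ pw π in qs , pw′ , Close-↭ σ close

-- The list `rows` holds what has been chosen so far, latest first; therefore a further choice `X`
-- arrives at the test as `X ʳ++ rows`.
select-answers : ∀ {d} k (M rows : List (Vec Entry d)) r →
  Answers (∃[ X ] ∃[ Y ] Interleaving X Y M × length X ≡ len k × Completable (len r) (X ʳ++ rows))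
          (select k (matrix M) (matrix rows) r)
select-answers leaf M rows r =
  answers-map (λ c → [] , M , right-all M , refl , c)
              (λ { ([] , _ , _ , _ , c) → c }) (test-answers rows r)
select-answers (node _ _) [] rows r = no λ { (_ , _ , [] , () , _) }
select-answers k@(node _ k′) (row ∷ M) rows r =
  answers-map
    [ (λ (X , Y , sp , eq , c) → row ∷ X , Y , consˡ sp , cong suc eq , c)
    , (λ (X , Y , sp , eq , c) → X , row ∷ Y , consʳ sp , eq , c) ]′
    (λ { (_ , _ , consˡ sp , eq , c) → inj₁ (_ , _ , sp , suc-injective eq , c)
       ; (_ , _ , consʳ sp , eq , c) → inj₂ (_ , _ , sp , eq , c) })
    (answers-or (select-answers k′ M (row ∷ rows) r) (select-answers k M rows r))

-- Bijections of positions as permutations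

tabulate⁺∘⁻ : ∀ {A : Set} {P : A → Set} {n} {f : Fin n → A} (p : Any P (tabulate f)) →
              (let i , q = tabulate⁻ p in tabulate⁺ i q) ≡ p
tabulate⁺∘⁻ {n = suc n} (here p)  = refl
tabulate⁺∘⁻ {n = suc n} (there p) = cong there (tabulate⁺∘⁻ p)

tabulate⁻∘⁺ : ∀ {A : Set} {P : A → Set} {n} {f : Fin n → A} i (p : P (f i)) →
              tabulate⁻ {P = P} {f = f} (tabulate⁺ i p) ≡ (i , p)
tabulate⁻∘⁺ zero    p = refl
tabulate⁻∘⁺ {f = f} (suc i) p = cong (λ (i , q) → suc i , q) (tabulate⁻∘⁺ {f = f ∘ suc} i p)

tabulate↔ : ∀ {A : Set} {P : A → Set} {n} {f : Fin n → A} →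
            (∃[ i ] P (f i)) ↔ Any P (tabulate f)
tabulate↔ {f = f} = mk↔ₛ′ (λ (i , p) → tabulate⁺ i p) tabulate⁻ tabulate⁺∘⁻
                          (λ (i , p) → tabulate⁻∘⁺ {f = f} i p)

-- A bijection of positions induces, for each element, a bijection between its occurrences in the
-- two lists. The lists are thus equal as bags, which is the same as being permutations of each
-- other.
tabulate-↭ : ∀ {A : Set} {n} (ys : List A) (α : Fin n ⤖ Fin (length ys)) →
             tabulate (List.lookup ys ∘ Bijection.to α) ↭ ys
tabulate-↭ ys α = subst (tabulate (List.lookup ys ∘ Bijection.to α) ↭_) (tabulate-lookup ys)
  (∼bag⇒↭ (tabulate↔ ↔-∘ (Σ.cong (⤖⇒↔ α) (↔-id _) ↔-∘ ↔-sym tabulate↔)))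

lookup-embed : ∀ {d} (p : Vec Bool d) i → Vec.lookup (embed p) i ≡ just (Vec.lookup p i)
lookup-embed p i = Vec.lookup-map i just p

hamming≡δ : ∀ {d} (p q : Vec Bool d) → δ (embed p) (embed q) ≡ hamming p q
hamming≡δ []          []          = refl
hamming≡δ (false ∷ p) (false ∷ q) = hamming≡δ p q
hamming≡δ (false ∷ p) (true  ∷ q) = cong suc (hamming≡δ p q)
hamming≡δ (true  ∷ p) (false ∷ q) = cong suc (hamming≡δ p q)
hamming≡δ (true  ∷ p) (true  ∷ q) = hamming≡δ p q

hamming≤d : ∀ {d} (p q : Vec Bool d) → hamming p q ≤ d
hamming≤d p q = subst (_≤ _) (hamming≡δ p q) (Vec.count≤n conflict? (Vec.zip (embed p) (embed q)))

fill : ∀ {d} → Vec Entry d → Vec Bool d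
fill []           = []
fill (□ ∷ a)      = false ∷ fill a
fill (just b ∷ a) = b ∷ fill a

fill-completes : ∀ {d} (a : Vec Entry d) → Completes a (fill a)
fill-completes (□ ∷ a)      zero    = inj₁ refl
fill-completes (just b ∷ a) zero    = inj₂ refl
fill-completes (□ ∷ a)      (suc i) = fill-completes a i
fill-completes (just b ∷ a) (suc i) = fill-completes a i

fill-all : ∀ {d} (M : List (Vec Entry d)) → Pointwise Completes M (map fill M)
fill-all []      = []
fill-all (a ∷ M) = fill-completes a ∷ fill-all M

-- Clusters correspond to selections of rows

Selectable : DiamInstance → Set
Selectable I = ∃[ X ] ∃[ Y ] Interleaving X Y M × length X ≡ k × Completable r X
  where open DiamInstance I

selectable⇒cluster : ∀ I → Selectable I → HasDiamCluster I
selectable⇒cluster I (X , Y , sp , |X|≡k , ps , pw , close)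
  -- The rows outside the cluster are unconstrained, so `fill` completes them arbitrarily.
  with M* , sp* , pw* ← pointwise-interleave sp pw (fill-all Y)
  = M* , (↔⇒⤖ (cast-id (Pointwise-length pw*)) , λ j i →
      [ inj₁ , (λ eq → inj₂ (trans (lookup-embed (List.lookup M* _) i) eq)) ]′
        (Pointwise.lookup⁺ pw* j i)) ,
    ps , (map fill Y , ↭-sym (toPermutation sp*)) ,
    trans (sym (Pointwise-length pw)) |X|≡k ,
    λ {p} {q} p∈ q∈ → subst (_≤ DiamInstance.r I) (sym (hamming≡δ p q)) (close p∈ q∈)

pointwise-completion : ∀ {d M* M} ((α , _) : _IsCompletionOf_ {d} M* M) →
  Pointwise Completes M (tabulate (List.lookup M* ∘ Bijection.to α))
pointwise-completion {M* = M*} {M} (α , completes) =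
  subst (λ M → Pointwise Completes M (tabulate (List.lookup M* ∘ Bijection.to α)))
    (tabulate-lookup M)
    (Pointwise.tabulate⁺ λ j i →
      [ inj₁ , (λ eq → inj₂ (trans (sym (lookup-embed (List.lookup M* _) i)) eq)) ]′
        (completes j i))

cluster⇒selectable : ∀ I → HasDiamCluster I → Selectable I
cluster⇒selectable I (M* , completion@(α , _) , P , (Q , P++Q↭M*) , |P|≡k , close)
  -- Reordering the rows of `M` makes their completion literally `P ++ Q`, so that `P` completes a
  -- prefix `X` of the reordered rows.
  with M′ , M↭M′ , pw ← pointwise-↭ʳ (pointwise-completion {M* = M*} completion)
                          (↭-trans (tabulate-↭ M* α) (↭-sym P++Q↭M*))
  with X , Y , refl , pwX ← pointwise-++ʳ P pw
  -- Undoing the reordering turns `X` into a choice in the order of `M`, up to a permutation that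
  -- completability tolerates.
  with X′ , Y′ , sp , X↭X′ ← interleaving-↭ (left-++-right X Y) (↭-sym M↭M′)
  = X′ , Y′ , sp ,
    trans (sym (↭-length X↭X′)) (trans (Pointwise-length pwX) |P|≡k) ,
    completable-↭ X↭X′ (P , pwX , λ {p} {q} p∈ q∈ →
      subst (_≤ DiamInstance.r I) (hamming≡δ p q) (close p∈ q∈))

-- Binary numerals and the truncation of `k` and `r`

doubleᵗ-encode : ∀ n → doubleᵗ (encodeℕᵇ n) ≡ encodeℕᵇ (ℕᵇ.double n)
doubleᵗ-encode ℕᵇ.zero  = refl
doubleᵗ-encode 2[1+ n ] = refl
doubleᵗ-encode 1+[2 n ] = cong (node tt) (doubleᵗ-encode n)

predᵗ-encode : ∀ n → predᵗ (encodeℕᵇ n) ≡ encodeℕᵇ (ℕᵇ.pred n)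
predᵗ-encode ℕᵇ.zero  = refl
predᵗ-encode 2[1+ n ] = refl
predᵗ-encode 1+[2 n ] = doubleᵗ-encode n

predᵗ-encodeℕ : ∀ n → predᵗ (encodeℕ (suc n)) ≡ encodeℕ n
predᵗ-encodeℕ n = trans (predᵗ-encode (ℕᵇ.fromℕ (suc n))) (cong encodeℕᵇ (sym (ℕᵇ.fromℕ-pred (suc n))))

encodeℕ-suc : ∀ n → ∃[ s ] ∃[ t ] encodeℕ (suc n) ≡ node s t
encodeℕ-suc n with ℕᵇ.fromℕ (suc n) | ℕᵇ.toℕ-fromℕ (suc n)
... | 2[1+ _ ] | _ = _ , _ , refl
... | 1+[2 _ ] | _ = _ , _ , refl

len-cap : ∀ u n → len (cap u (encodeℕ n)) ≡ len u ⊓ n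
len-cap leaf       n       = refl
len-cap (node _ u) zero    = refl
len-cap (node _ u) (suc n) with encodeℕ (suc n) | encodeℕ-suc n | predᵗ-encodeℕ n
... | _ | _ , _ , refl | eq = cong suc (trans (cong (len ∘ cap u) eq) (len-cap u n))

len-vector : ∀ {d} (a : Vec Entry d) → len (encodeVector a) ≡ d
len-vector []      = refl
len-vector (_ ∷ a) = cong suc (len-vector a)

firstRow : Tree → Tree
firstRow M = caseTree M leaf (λ row _ → row)

-- Distances never exceed d, which is the length of the first row if there is any.
cap-close : ∀ {d} (M : List (Vec Entry d)) r {X Y ps} → Interleaving X Y M → Pointwise Completes X ps →
  let ρ = len (cap (firstRow (matrix M)) (encodeℕ r)) in
  (Close r ps → Close ρ ps) × (Close ρ ps → Close r ps)
cap-close []      r [] [] = (λ _ ()) , (λ _ ())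
cap-close (a ∷ M) r sp pw
  rewrite len-cap (encodeVector a) r | len-vector a
  = (λ close {p} {q} p∈ q∈ → ⊓-glb (hamming≤d p q) (close p∈ q∈))
  , (λ close {p} {q} p∈ q∈ → ≤-trans (close p∈ q∈) (m⊓n≤n _ r))

-- The truncation is at `length M + 1`, not `length M`: if `k` exceeds the number of rows, then so
-- must the truncated value, or a negative instance could become a positive one.
cap-length : ∀ {d} {X Y M : List (Vec Entry d)} k → Interleaving X Y M →
  let κ = len (cap (node leaf (matrix M)) (encodeℕ k)) in
  (length X ≡ k → length X ≡ κ) × (length X ≡ κ → length X ≡ k)
cap-length {X = X} {Y} {M} k sp
  rewrite len-cap (node leaf (matrix M)) k | len-matrix M
  = (λ { refl → sym (m≥n⇒m⊓n≡n (m≤n⇒m≤1+n |X|≤|M|)) }) , to-k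
  where
  |X|≤|M| : length X ≤ length M
  |X|≤|M| = subst (length X ≤_) (sym (interleave-length sp)) (m≤m+n _ _)

  to-k : length X ≡ suc (length M) ⊓ k → length X ≡ k
  to-k eq with ⊓-sel (suc (length M)) k
  ... | inj₁ ≡M = ⊥-elim (<-irrefl (trans eq ≡M) (s≤s |X|≤|M|))
  ... | inj₂ ≡k = trans eq ≡k

decideᵗ : DiamInstance → Tree
decideᵗ I = select (cap (node leaf (matrix M)) (encodeℕ k)) (matrix M) leaf
                   (cap (firstRow (matrix M)) (encodeℕ r))
  where open DiamInstance I

decide-answers : ∀ I → Answers (HasDiamCluster I) (decideᵗ I)
decide-answers I = answers-map
  (λ (X , Y , sp , len≡ , c) → selectable⇒cluster I
     (X , Y , sp , proj₂ (cap-length k sp) len≡ , uncap sp (completable-↭ (↭-reverse X) c)))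
  (λ has → let X , Y , sp , len≡ , c = cluster⇒selectable I has in
     X , Y , sp , proj₁ (cap-length k sp) len≡ , completable-↭ (↭-sym (↭-reverse X)) (recap sp c))
  (select-answers (cap (node leaf (matrix M)) (encodeℕ k)) M [] (cap (firstRow (matrix M)) (encodeℕ r)))
  where
  open DiamInstance I
  ρ = len (cap (firstRow (matrix M)) (encodeℕ r))

  recap : ∀ {X Y} → Interleaving X Y M → Completable r X → Completable ρ X
  recap sp (ps , pw , close) = ps , pw , proj₁ (cap-close M r sp pw) close

  uncap : ∀ {X Y} → Interleaving X Y M → Completable ρ X → Completable r X
  uncap sp (ps , pw , close) = ps , pw , proj₂ (cap-close M r sp pw) close

-- Sizes of the tries

data Sections (P : Tree → Set) : ℕ → Tree → Set where
  leaf : ∀ {n} → Sections P n leaf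
  node : ∀ {n s S} → P s → Sections P n S → Sections P (suc n) (node s S)

-- Tries of dimension m whose lists of sections have at most ρ entries.
Box : ℕ → ℕ → Tree → Set
Box ρ zero    = Sections (_≡ leaf) 1
Box ρ (suc m) = Sections (Box ρ m) ρ

sections-weaken : ∀ {P n S} → Sections P n S → Sections P (suc n) S
sections-weaken leaf       = leaf
sections-weaken (node p S) = node p (sections-weaken S)

sections-∪ : ∀ {P n S T} → (∀ {s t} → P s → P t → P (s ∪ t)) →
             Sections P n S → Sections P n T → Sections P n (S ∪ T)
sections-∪ ∪-P leaf       T          = T
sections-∪ ∪-P (node p S) leaf       = node p S
sections-∪ ∪-P (node p S) (node q T) = node (∪-P p q) (sections-∪ ∪-P S T)

-- Equal vectors share their place in a trie, so a union does not leave the box. This keeps the size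
-- bound independent of the number of unions and columns.
box-∪ : ∀ {ρ} m {S T} → Box ρ m S → Box ρ m T → Box ρ m (S ∪ T)
box-∪ zero    = sections-∪ λ { refl refl → refl }
box-∪ (suc m) = sections-∪ (box-∪ m)

sections-dropIf : ∀ {P n S} b → Sections P n S → Sections P n (dropIf b S)
sections-dropIf leaf       S          = S
sections-dropIf (node _ _) leaf       = leaf
sections-dropIf (node _ _) (node _ S) = sections-weaken S

-- Each bit consumes one dimension, hence `len l ≤ m`; lowering a coordinate can only shorten a list
-- of sections.
box-shift : ∀ {ρ} m {S} l → len l ≤ m → Box ρ m S → Box ρ m (shift l S)
box-shiftEach : ∀ {ρ} m {n S} l → len l ≤ m →
                Sections (Box ρ m) n S → Sections (Box ρ m) n (shiftEach l S)

box-shift m       leaf       _         S = S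
box-shift (suc m) (node b l) (s≤s l≤m) S = box-shiftEach m l l≤m (sections-dropIf b S)

box-shiftEach m l l≤m leaf       = leaf
box-shiftEach m l l≤m (node s S) = node (box-shift m l l≤m s) (box-shiftEach m l l≤m S)

-- This is `n(n-1)/2`, in the recursion that `costs` follows.
pairs : ℕ → ℕ
pairs zero    = 0
pairs (suc n) = n + pairs n

pairs≤ : ∀ n → pairs n ≤ n * n
pairs≤ zero    = z≤n
pairs≤ (suc n) = ≤-trans (+-mono-≤ (n≤1+n n) (pairs≤ n)) (+-monoʳ-≤ (suc n) (*-monoʳ-≤ n (n≤1+n n)))

len-costs : ∀ c → len (costs c) ≡ pairs (len c)
len-costs leaf       = refl
len-costs (node b c) = trans (len-xorEach c) (cong (len c +_) (len-costs c))
  where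
  len-xorEach : ∀ c {l} → len (xorEach b c l) ≡ len c + len l
  len-xorEach leaf       = refl
  len-xorEach (node _ c) = cong suc (len-xorEach c)

len-tails : ∀ rows → len (tails rows) ≡ len rows
len-tails leaf          = refl
len-tails (node _ rows) = cong suc (len-tails rows)

len<size : ∀ t → len t < size t
len<size leaf       = ≤-refl
len<size (node s t) = s≤s (≤-trans (len<size t) (m≤n+m (size t) (size s)))

box-step : ∀ {ρ K} rows c {S} → len rows + len c ≡ K →
           Box ρ (pairs K) S → Box ρ (pairs K) (step rows c S)
box-step leaf                            c refl S =
  box-shift _ (costs c) (≤-reflexive (len-costs c)) S
box-step (node leaf rows)                c _    S = S
box-step {K = K} (node (node leaf _) rows) c eq S =
  box-∪ (pairs K) (box-step rows (node leaf c) (trans (+-suc _ _) eq) S)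
                  (box-step rows (node tt c)   (trans (+-suc _ _) eq) S)
box-step (node (node (node b _) _) rows) c eq   S =
  box-step rows (node b c) (trans (+-suc _ _) eq) S

box-repeat : ∀ {P} r {S} → P S → Sections P (suc (len r)) (repeat r S)
box-repeat leaf       p = node p leaf
box-repeat (node _ r) p = node p (box-repeat r p)

box-full : ∀ c r → Box (suc (len r)) (pairs (len c)) (full c r)
box-full leaf       r = node refl leaf
box-full (node _ c) r = box-wrap c (box-full c r)
  where
  box-wrap : ∀ c {m S} → Box (suc (len r)) m S → Box (suc (len r)) (len c + m) (wrap c r S)
  box-wrap leaf       S = S
  box-wrap (node _ c) S = box-repeat r (box-wrap c S)

boxSize : ℕ → ℕ → ℕ
-- In dimension 0 the largest set consists of the empty vector alone; it is `tt`, of size 3.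
boxSize ρ zero    = 3
boxSize ρ (suc m) = ρ * suc (boxSize ρ m) + 1

sections-size : ∀ {P n S} φ → (∀ {s} → P s → size s ≤ φ) → Sections P n S → size S ≤ n * suc φ + 1
sections-size {n = n} φ P≤φ leaf = m≤n+m 1 (n * suc φ)
sections-size {n = suc n} φ P≤φ (node {S = S} p s) = s≤s (≤-trans
  (+-mono-≤ (P≤φ p) (sections-size φ P≤φ s)) (≤-reflexive (sym (+-assoc φ (n * suc φ) 1))))

box-size : ∀ {ρ} m {S} → Box ρ m S → size S ≤ boxSize ρ m
box-size zero    = sections-size 1 λ { refl → ≤-refl }
box-size (suc m) = sections-size _ (box-size m)

-- The 2 added to `ρ` absorbs the additive terms of each dimension, and 4 is `suc (boxSize ρ 0)`.
boxSize≤ : ∀ ρ m → suc (boxSize ρ m) ≤ 4 * (2 + ρ) ^ m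
boxSize≤ ρ zero    = ≤-refl
boxSize≤ ρ (suc m) = begin
  suc (ρ * suc φ + 1)         ≤⟨ ≤-by (2 * φ) (eq ρ φ) ⟩
  (2 + ρ) * suc φ             ≤⟨ *-monoʳ-≤ (2 + ρ) (boxSize≤ ρ m) ⟩
  (2 + ρ) * (4 * (2 + ρ) ^ m) ≡⟨ swap-4 (2 + ρ) ((2 + ρ) ^ m) ⟩
  4 * (2 + ρ) ^ suc m         ∎
  where
  open ≤-Reasoning
  φ = boxSize ρ m
  eq : ∀ ρ φ → 1 + (ρ * suc φ + 1) + 2 * φ ≡ (2 + ρ) * suc φ
  eq = solve-∀
  swap-4 : ∀ a b → a * (4 * b) ≡ 4 * (a * b)
  swap-4 = solve-∀

-- Closed forms for the call counts

costsCalls≤ : ∀ c → costsCalls c ≤ suc (len c) * suc (len c)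
costsCalls≤ leaf       = ≤-refl
costsCalls≤ (node _ c) = ≤-trans (s≤s (+-monoˡ-≤ (suc (len c)) (costsCalls≤ c))) (≤-by _ (eq (len c)))
  where
  eq : ∀ l → 1 + (suc l * suc l + suc l) + suc l ≡ suc (suc l) * suc (suc l)
  eq = solve-∀

wrapCalls≤ : ∀ c r → wrapCalls c r ≤ suc (len c) * (2 + len r)
wrapCalls≤ leaf       r = s≤s z≤n
wrapCalls≤ (node _ c) r = ≤-trans (s≤s (+-monoˡ-≤ (suc (len r)) (wrapCalls≤ c r)))
  (≤-reflexive (eq (suc (len c)) (len r)))
  where
  eq : ∀ l ρ → 1 + (l * (2 + ρ) + suc ρ) ≡ suc l * (2 + ρ)
  eq = solve-∀

fullCalls≤ : ∀ c r → fullCalls c r ≤ suc (len c) * (suc (len c) * (2 + len r))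
fullCalls≤ leaf       r = s≤s z≤n
fullCalls≤ (node _ c) r = ≤-trans (s≤s (+-mono-≤ (fullCalls≤ c r) (wrapCalls≤ c r)))
  (≤-by _ (eq (suc (len c)) (len r)))
  where
  eq : ∀ l ρ → 1 + (l * (l * (2 + ρ)) + l * (2 + ρ)) + (l * (2 + ρ) + suc ρ) ≡ suc l * (suc l * (2 + ρ))
  eq = solve-∀

stepBase : ℕ → ℕ → ℕ
stepBase K φ = suc (suc K * suc K + suc (2 * φ)) + suc φ

double-product : ∀ a w → a * w + a * w ≡ 2 * a * w
double-product = solve-∀

-- Adding the bound suc φ on the cost of one union makes the recursion a doubling.
stepCalls≤ : ∀ {ρ K} rows c {S} → len rows + len c ≡ K → let φ = boxSize ρ (pairs K) in
  Box ρ (pairs K) S → stepCalls rows c S + suc φ ≤ 2 ^ len rows * stepBase K φ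
stepCalls≤ leaf c refl box = ≤-trans
  (+-monoˡ-≤ _ (s≤s (+-mono-≤ (costsCalls≤ c) (s≤s (*-monoʳ-≤ 2 (box-size (pairs (len c)) box))))))
  (≤-reflexive (sym (*-identityˡ _)))
stepCalls≤ {ρ} {K} (node leaf rows) c eq box = let φ = boxSize ρ (pairs K) in
  ≤-trans (+-monoˡ-≤ (suc φ) (s≤s {n = suc K * suc K + suc (2 * φ)} z≤n)) (m≤n*m _ (2 ^ suc (len rows)) {{m^n≢0 2 (suc (len rows))}})
stepCalls≤ {ρ} {K} (node (node leaf _) rows) c {S} eq box = begin
  suc (A + B + size (step rows (node leaf c) S)) + suc φ
    ≤⟨ +-monoˡ-≤ (suc φ) (s≤s (+-monoʳ-≤ (A + B)
         (box-size (pairs K) (box-step rows (node leaf c) eq′ box)))) ⟩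
  suc (A + B + φ) + suc φ                   ≡⟨ share-φ A B φ ⟩
  (A + suc φ) + (B + suc φ)                 ≤⟨ +-mono-≤ (stepCalls≤ rows (node leaf c) eq′ box)
                                                        (stepCalls≤ rows (node tt c) eq′ box) ⟩
  2 ^ len rows * W + 2 ^ len rows * W       ≡⟨ double-product (2 ^ len rows) W ⟩
  2 ^ suc (len rows) * W                    ∎
  where
  open ≤-Reasoning
  eq′ = trans (+-suc (len rows) (len c)) eq
  φ = boxSize ρ (pairs K)
  W = stepBase K φ
  A = stepCalls rows (node leaf c) S
  B = stepCalls rows (node tt c) S
  share-φ : ∀ a b φ → 1 + (a + b + φ) + suc φ ≡ (a + suc φ) + (b + suc φ)
  share-φ = solve-∀
stepCalls≤ {ρ} {K} (node (node (node b _) _) rows) c {S} eq box = begin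
  1 + (stepCalls rows (node b c) S + suc φ)
    ≤⟨ +-mono-≤ (*-mono-≤ (m^n>0 2 (len rows)) (s≤s z≤n))
                (stepCalls≤ rows (node b c) (trans (+-suc _ _) eq) box) ⟩
  2 ^ len rows * W + 2 ^ len rows * W       ≡⟨ double-product (2 ^ len rows) W ⟩
  2 ^ suc (len rows) * W                    ∎
  where
  open ≤-Reasoning
  φ = boxSize ρ (pairs K)
  W = stepBase K φ

-- The first summand pays for the final check, the second for one column.
processBase : ℕ → ℕ → ℕ
processBase K φ = suc (suc K * suc K + suc (K * K)) + suc (suc K + 2 ^ K * stepBase K φ)

processCalls≤ : ∀ {ρ K} u rows {S} → len rows ≡ K → let φ = boxSize ρ (pairs K) in
  Box ρ (pairs K) S → processCalls u rows S ≤ suc (len u) * processBase K φ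
processCalls≤ leaf rows refl box = ≤-trans
  (s≤s (+-mono-≤ (costsCalls≤ rows)
    (s≤s (≤-trans (≤-reflexive (len-costs rows)) (pairs≤ (len rows))))))
  (≤-trans (m≤m+n _ _) (m≤m+n _ 0))
processCalls≤ {K = K} (node _ u) rows {S} refl box = +-mono-≤
  (≤-trans
    (s≤s (+-monoʳ-≤ (suc K) (m+n≤o⇒m≤o _ (stepCalls≤ rows leaf (+-identityʳ K) box))))
    (m≤n+m _ (suc (suc K * suc K + suc (K * K)))))
  (processCalls≤ u (tails rows) (len-tails rows) (box-step rows leaf (+-identityʳ K) box))

-- Taking or skipping the first row gives Pascal's recursion, and `n^(k-1) + n^k` is at most
-- `(n+1)^k`. The `suc` on the left pays for the call itself. Moving a row from `M` to `rows`
-- preserves their total size, so `Z` bounds every choice that is tested.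
selectCalls≤ : ∀ {Z τ K} k M rows r →
  (∀ rows → len rows ≡ K → size rows ≤ Z → testCalls rows r ≤ τ) →
  len k + len rows ≡ K → size M + size rows ≤ Z →
  suc (selectCalls k M rows r) ≤ (2 + τ) * suc (len M) ^ len k
selectCalls≤ leaf M rows r test≤τ |rows|≡K size≤Z = ≤-trans
  (s≤s (s≤s (test≤τ rows |rows|≡K (m+n≤o⇒n≤o (size M) size≤Z))))
  (≤-reflexive (sym (*-identityʳ _)))
selectCalls≤ {τ = τ} (node _ k) leaf rows r _ _ _ =
  *-mono-≤ {2} {2 + τ} (s≤s (s≤s z≤n)) (m^n>0 1 (suc (len k)))
selectCalls≤ {Z} {τ} k@(node _ k′) (node row M) rows r test≤τ len≡K size≤Z = begin
  suc (suc (A + B))          ≡⟨ cong suc (+-suc A B) ⟨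
  suc A + suc B
    ≤⟨ +-mono-≤
         (selectCalls≤ k′ M (node row rows) r test≤τ
           (trans (+-suc (len k′) (len rows)) len≡K)
           (≤-trans (≤-reflexive (move (size row) (size M) (size rows))) size≤Z))
         (selectCalls≤ k M rows r test≤τ len≡K
           (≤-trans (+-monoˡ-≤ (size rows) (m≤n⇒m≤1+n (m≤n+m (size M) (size row)))) size≤Z)) ⟩
  (2 + τ) * n ^ len k′ + (2 + τ) * (n * n ^ len k′)   ≡⟨ factor (2 + τ) n (n ^ len k′) ⟩
  (2 + τ) * (suc n * n ^ len k′)
    ≤⟨ *-monoʳ-≤ (2 + τ) (*-monoʳ-≤ (suc n) (^-monoˡ-≤ (len k′) (n≤1+n n))) ⟩
  (2 + τ) * (suc n * suc n ^ len k′)                  ∎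
  where
  open ≤-Reasoning
  n = suc (len M)
  A = selectCalls k′ M (node row rows) r
  B = selectCalls k M rows r
  move : ∀ a b c → b + suc (a + c) ≡ 1 + (a + b) + c
  move = solve-∀
  factor : ∀ t n x → t * x + t * (n * x) ≡ t * (suc n * x)
  factor = solve-∀

-- Bounds by powers of a common base

module PowerBounds (B : ℕ) (4≤B : 4 ≤ B) where

  infix  4 _≼_
  infixl 6 _⊞_
  infixl 7 _⊠_

  -- Products add exponents, and sums add them with one more for the factor 2. As a record it
  -- exposes `x` and `a` to unification, so the exponents are inferred from the shape of the
  -- expression.
  record _≼_ (x a : ℕ) : Set where
    constructor bounded
    field bound : x ≤ B ^ a

  open _≼_ public

  B-nonZero : NonZero B
  B-nonZero = >-nonZero (≤-trans (s≤s z≤n) 4≤B)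

  base : ∀ {x} → x ≤ B → x ≼ 1
  base x≤B = bounded (≤-trans x≤B (≤-reflexive (sym (*-identityʳ B))))

  ≼-trans : ∀ {x y a} → x ≤ y → y ≼ a → x ≼ a
  ≼-trans x≤y (bounded y≤) = bounded (≤-trans x≤y y≤)

  ≼-one : 1 ≼ 0
  ≼-one = bounded ≤-refl

  _⊠_ : ∀ {x y a b} → x ≼ a → y ≼ b → x * y ≼ a + b
  _⊠_ {a = a} {b} (bounded x≤) (bounded y≤) =
    bounded (≤-trans (*-mono-≤ x≤ y≤) (≤-reflexive (sym (^-distribˡ-+-* B a b))))

  _⊞_ : ∀ {x y a b} → x ≼ a → y ≼ b → x + y ≼ suc (a + b)
  _⊞_ {a = a} {b} (bounded x≤) (bounded y≤) = bounded (≤-trans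
    (+-mono-≤ (≤-trans x≤ (^-monoʳ-≤ B {{B-nonZero}} (m≤m+n a b)))
              (≤-trans y≤ (≤-trans (^-monoʳ-≤ B {{B-nonZero}} (m≤n+m b a)) (m≤m+n _ 0))))
    (*-monoˡ-≤ (B ^ (a + b)) (≤-trans (s≤s (s≤s z≤n)) 4≤B)))

  ≼-suc : ∀ {x a} → x ≼ a → suc x ≼ suc a
  ≼-suc x≼a = ≼-one ⊞ x≼a

  -- The hypotheses put everything that depends on the number of rows below `B`, so a numeral
  -- suffices as exponent; 29 is what the rules for sums and products yield.
  testCalls≼ : ∀ rows r → suc (len rows) ≤ B → 3 + len r ≤ B → 2 ^ len rows ≤ B →
    (3 + len r) ^ pairs (len rows) ≤ B → size rows ≤ B → testCalls rows r ≼ 29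
  testCalls≼ leaf              r _ _ _ _ _ = bounded (m^n>0 B {{B-nonZero}} 29)
  testCalls≼ rows@(node row rest) r sK≤B 3+r≤B 2^K≤B boxes≤B size≤B =
    ≼-suc (≼-full ⊞ ≼-process)
    where
    K = len rows
    φ = boxSize (suc (len r)) (pairs K)

    ≼-sK : suc K ≼ 1
    ≼-sK = base sK≤B

    ≼-K : K ≼ 1
    ≼-K = ≼-trans (n≤1+n K) ≼-sK

    ≼-sφ : suc φ ≼ 2
    ≼-sφ = ≼-trans (boxSize≤ (suc (len r)) (pairs K)) (base 4≤B ⊠ base boxes≤B)

    ≼-φ : φ ≼ 2
    ≼-φ = ≼-trans (n≤1+n φ) ≼-sφ

    ≼-stepBase : stepBase K φ ≼ 11
    ≼-stepBase = ≼-suc (≼-sK ⊠ ≼-sK ⊞ ≼-suc (base (≤-trans (s≤s (s≤s z≤n)) 4≤B) ⊠ ≼-φ)) ⊞ ≼-sφ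

    ≼-processBase : processBase K φ ≼ 23
    ≼-processBase = ≼-suc (≼-sK ⊠ ≼-sK ⊞ ≼-suc (≼-K ⊠ ≼-K)) ⊞ ≼-suc (≼-sK ⊞ base 2^K≤B ⊠ ≼-stepBase)

    row<rows : suc (len row) ≤ size rows
    row<rows = ≤-trans (len<size row) (m≤n⇒m≤1+n (m≤m+n (size row) (size rest)))

    ≼-process : processCalls row rows (full rows r) ≼ 24
    ≼-process = ≼-trans (processCalls≤ row rows refl (box-full rows r))
      (base (≤-trans row<rows size≤B) ⊠ ≼-processBase)

    ≼-full : fullCalls rows r ≼ 3
    ≼-full = ≼-trans (fullCalls≤ rows r)
      (≼-sK ⊠ (≼-sK ⊠ base (≤-trans (n≤1+n (2 + len r)) 3+r≤B)))

len-cap≤ : ∀ u n → len (cap u n) ≤ len u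
len-cap≤ leaf       n            = z≤n
len-cap≤ (node _ u) leaf         = z≤n
len-cap≤ (node _ u) n@(node _ _) = s≤s (len-cap≤ u (predᵗ n))

size-firstRow : ∀ M → size (firstRow M) ≤ size M
size-firstRow leaf       = ≤-refl
size-firstRow (node s t) = m≤n⇒m≤1+n (m≤m+n (size s) (size t))

calls-decide : ∀ I → let open DiamInstance I in
  calls decide (encodeInstance I ∷ []) ≡
  suc (suc (len (matrix M))) * (3 + len (encodeℕ k)) +
  (suc (len (firstRow (matrix M))) * (3 + len (encodeℕ r)) + 0) +
  selectCalls (cap (node leaf (matrix M)) (encodeℕ k)) (matrix M) leaf
              (cap (firstRow (matrix M)) (encodeℕ r))
calls-decide record { M = [] }    = refl
calls-decide record { M = _ ∷ _ } = refl

-- Running time on an instance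

module Time (I : DiamInstance) where
  open DiamInstance I

  -- The exponent `q` is at least `K`, at least `pairs K`, and at least 1 even for `k = 0`. Hence
  -- the one base `B` dominates `N`, the number of completions of a column, the box of budgets and
  -- the factor for the choices of rows.
  N q B K : ℕ
  N = size (encodeInstance I)
  q = suc k * suc k
  B = N ^ q

  Mᵗ kᵗ rᵗ : Tree
  Mᵗ = matrix M
  kᵗ = cap (node leaf Mᵗ) (encodeℕ k)
  rᵗ = cap (firstRow Mᵗ) (encodeℕ r)
  K = len kᵗ

  3+M≤N : 3 + size Mᵗ ≤ N
  3+M≤N = s≤s (≤-trans (≤-reflexive (+-comm 2 (size Mᵗ))) (+-monoʳ-≤ (size Mᵗ)
    (s≤s (≤-trans (size>0 (encodeℕ k)) (m≤m+n _ _)))))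
    where
    size>0 : ∀ t → 1 ≤ size t
    size>0 t = ≤-trans (s≤s z≤n) (len<size t)

  M<N : suc (size Mᵗ) ≤ N
  M<N = ≤-trans (m≤n+m (suc (size Mᵗ)) 2) 3+M≤N

  4≤N : 4 ≤ N
  4≤N = ≤-trans (+-monoʳ-≤ 3 (≤-trans (s≤s z≤n) (len<size Mᵗ))) 3+M≤N

  N-nonZero : NonZero N
  N-nonZero = >-nonZero (≤-trans (s≤s z≤n) 4≤N)

  k<N : suc (len (encodeℕ k)) ≤ N
  k<N = ≤-trans (len<size (encodeℕ k))
    (≤-trans (m≤m+n _ (size (encodeℕ r))) (m≤n⇒m≤1+n (≤-trans (n≤1+n _) (m≤n+m _ (size Mᵗ)))))

  r<N : suc (len (encodeℕ r)) ≤ N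
  r<N = ≤-trans (len<size (encodeℕ r))
    (≤-trans (m≤n+m _ (size (encodeℕ k))) (m≤n⇒m≤1+n (≤-trans (n≤1+n _) (m≤n+m _ (size Mᵗ)))))

  2+M≤N : suc (suc (len Mᵗ)) ≤ N
  2+M≤N = ≤-trans (s≤s (len<size Mᵗ)) M<N

  M≤N : suc (len Mᵗ) ≤ N
  M≤N = ≤-trans (n≤1+n _) 2+M≤N

  row<M : suc (len (firstRow Mᵗ)) ≤ size Mᵗ
  row<M = ≤-trans (len<size (firstRow Mᵗ)) (size-firstRow Mᵗ)

  3+r≤N : 3 + len rᵗ ≤ N
  3+r≤N = ≤-trans (+-monoʳ-≤ 2 (≤-trans (s≤s (len-cap≤ (firstRow Mᵗ) (encodeℕ r))) row<M))
                  (≤-trans (n≤1+n _) 3+M≤N)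

  K≤k : K ≤ k
  K≤k = ≤-trans (≤-reflexive (len-cap (node leaf Mᵗ) k)) (m⊓n≤n _ k)

  ^≤B : ∀ {x e} → x ≤ N → e ≤ q → x ^ e ≤ B
  ^≤B {x} {e} x≤N e≤q = ≤-trans (^-monoˡ-≤ e x≤N) (^-monoʳ-≤ N {{N-nonZero}} e≤q)

  ≤B : ∀ {x} → x ≤ N → x ≤ B
  ≤B {x} x≤N = ≤-trans (≤-reflexive (sym (^-identityʳ x))) (^≤B x≤N (s≤s z≤n))

  K≤q : K ≤ q
  K≤q = ≤-trans K≤k (≤-trans (n≤1+n k) (m≤m*n (suc k) (suc k)))

  pairs≤q : pairs K ≤ q
  pairs≤q = ≤-trans (pairs≤ K) (*-mono-≤ (m≤n⇒m≤1+n K≤k) (m≤n⇒m≤1+n K≤k))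

  K≤M : K ≤ suc (len Mᵗ)
  K≤M = len-cap≤ (node leaf Mᵗ) (encodeℕ k)

  open PowerBounds B (≤B 4≤N)

  test≼ : ∀ rows → len rows ≡ K → size rows ≤ suc (size Mᵗ) → testCalls rows rᵗ ≼ 29
  test≼ rows |rows|≡K size≤ = testCalls≼ rows rᵗ
    (≤B (subst (λ K → suc K ≤ N) (sym |rows|≡K) (≤-trans (s≤s K≤M) 2+M≤N)))
    (≤B 3+r≤N)
    (subst (λ K → 2 ^ K ≤ B) (sym |rows|≡K) (^≤B (≤-trans (s≤s (s≤s z≤n)) 4≤N) K≤q))
    (subst (λ K → (3 + len rᵗ) ^ pairs K ≤ B) (sym |rows|≡K) (^≤B 3+r≤N pairs≤q))
    (≤B (≤-trans size≤ M<N))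

  calls≼ : calls decide (encodeInstance I ∷ []) ≼ 43
  calls≼ = subst (_≼ 43) (sym (calls-decide I))
    (base (≤B 2+M≤N) ⊠ ≼-suc (≼-suc (base (≤B k<N))) ⊞
     (base (≤B (≤-trans row<M (≤-trans (n≤1+n _) M<N))) ⊠ ≼-suc (≼-suc (base (≤B r<N))) ⊞ ≼-trans z≤n ≼-one) ⊞
     ≼-trans (n≤1+n _)
       (≼-trans (selectCalls≤ kᵗ Mᵗ leaf rᵗ (λ rows |rows|≡K size≤ → bound (test≼ rows |rows|≡K size≤))
                   (+-identityʳ K) (≤-reflexive (+-comm (size Mᵗ) 1)))
                (≼-suc (≼-suc (bounded {a = 29} ≤-refl)) ⊠ base (^≤B M≤N K≤q))))

  calls≤B^43 : calls decide (encodeInstance I ∷ []) ≤ B ^ 43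
  calls≤B^43 = bound calls≼

-- A computable exponent

-- Quadrupling at every binary digit of k gives at least a quadratic function of k
-- and needs no multiplication program.
exponentᵇ : ℕᵇ → ℕᵇ
exponentᵇ ℕᵇ.zero  = exponent₀
exponentᵇ 2[1+ n ] = ℕᵇ.double (ℕᵇ.double (exponentᵇ n))
exponentᵇ 1+[2 n ] = ℕᵇ.double (ℕᵇ.double (exponentᵇ n))

quadruple-encode : ∀ {t} n → t ≡ encodeℕᵇ n →
                   doubleᵗ (doubleᵗ t) ≡ encodeℕᵇ (ℕᵇ.double (ℕᵇ.double n))
quadruple-encode n refl = trans (cong doubleᵗ (doubleᵗ-encode n)) (doubleᵗ-encode (ℕᵇ.double n))

exponentᵗ-encode : ∀ n → exponentᵗ (encodeℕᵇ n) ≡ encodeℕᵇ (exponentᵇ n)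
exponentᵗ-encode ℕᵇ.zero  = refl
exponentᵗ-encode 2[1+ n ] = quadruple-encode (exponentᵇ n) (exponentᵗ-encode n)
exponentᵗ-encode 1+[2 n ] = quadruple-encode (exponentᵇ n) (exponentᵗ-encode n)

exponent : ℕ → ℕ
exponent k = ℕᵇ.toℕ (exponentᵇ (ℕᵇ.fromℕ k))

quadruple-square : ∀ c n → c * ((4 + 2 * n) * (4 + 2 * n)) ≡ 2 * (2 * (c * ((2 + n) * (2 + n))))
quadruple-square = solve-∀

-- A further digit turns `n` into `1 + 2n` or `2 + 2n`, so it at most doubles `2 + n` and at most
-- quadruples its square. The offset 2 is what makes this exact for the larger digit.
exponent-lower-bound : ∀ n → let x = 2 + ℕᵇ.toℕ n in 127 * (x * x) ≤ ℕᵇ.toℕ (exponentᵇ n)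
exponent-lower-bound-step : ∀ n {x} → x ≤ 4 + 2 * ℕᵇ.toℕ n →
  127 * (x * x) ≤ ℕᵇ.toℕ (ℕᵇ.double (ℕᵇ.double (exponentᵇ n)))

-- Here `exponent₀` is 510, and 508 is `127 * (2 * 2)`.
exponent-lower-bound ℕᵇ.zero  = m≤m+n 508 2
exponent-lower-bound 2[1+ n ] =
  exponent-lower-bound-step n (+-monoʳ-≤ 2 (≤-reflexive (*-suc 2 (ℕᵇ.toℕ n))))
exponent-lower-bound 1+[2 n ] = exponent-lower-bound-step n (n≤1+n _)

exponent-lower-bound-step n {x} x≤ = begin
  127 * (x * x)                                       ≤⟨ *-monoʳ-≤ 127 (*-mono-≤ x≤ x≤) ⟩
  127 * ((4 + 2 * ℕᵇ.toℕ n) * (4 + 2 * ℕᵇ.toℕ n))     ≡⟨ quadruple-square 127 (ℕᵇ.toℕ n) ⟩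
  2 * (2 * (127 * ((2 + ℕᵇ.toℕ n) * (2 + ℕᵇ.toℕ n))))
    ≤⟨ *-monoʳ-≤ 2 (*-monoʳ-≤ 2 (exponent-lower-bound n)) ⟩
  2 * (2 * ℕᵇ.toℕ (exponentᵇ n))                      ≡⟨ cong (2 *_) (ℕᵇ.toℕ-double (exponentᵇ n)) ⟨
  2 * ℕᵇ.toℕ (ℕᵇ.double (exponentᵇ n))                ≡⟨ ℕᵇ.toℕ-double (ℕᵇ.double (exponentᵇ n)) ⟨
  ℕᵇ.toℕ (ℕᵇ.double (ℕᵇ.double (exponentᵇ n)))        ∎
  where open ≤-Reasoning

exponent≥ : ∀ k → suc k * suc k * 43 ≤ exponent k
exponent≥ k = begin
  suc k * suc k * 43                    ≡⟨ *-comm (suc k * suc k) 43 ⟩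
  43 * (suc k * suc k)                  ≤⟨ *-mono-≤ (m≤m+n 43 84) (*-mono-≤ (n≤1+n (suc k)) (n≤1+n (suc k))) ⟩
  127 * ((2 + k) * (2 + k))
    ≤⟨ subst (λ n → 127 * ((2 + n) * (2 + n)) ≤ exponent k) (ℕᵇ.toℕ-fromℕ k)
             (exponent-lower-bound (ℕᵇ.fromℕ k)) ⟩
  exponent k                            ∎
  where open ≤-Reasoning

computeExponent : Expr arities 1
computeExponent = call EXPONENT (x0 ∷ [])

exponent-computable : Computable exponent
exponent-computable = program computeExponent , λ k → _ ,
  outputs (encodeℕ k)
    (trans (exponentᵗ-encode (ℕᵇ.fromℕ k)) (cong encodeℕᵇ (sym (ℕᵇ.fromℕ-toℕ _))))
    (n≤1+n _) (s≤s z≤n)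
  where open Adequacy (program computeExponent) F C F-correct C-correct 60 bodies≤60

power-bound : ∀ m a b {c} → 1 ≤ m → a * b ≤ c → (m ^ a) ^ b ≤ m ^ c
power-bound m a b 1≤m ab≤c =
  ≤-trans (≤-reflexive (^-*-assoc m a b)) (^-monoʳ-≤ m {{>-nonZero 1≤m}} ab≤c)

module _ (I : DiamInstance) where
  open DiamInstance I
  open Time I

  1≤N : 1 ≤ N
  1≤N = ≤-trans (s≤s z≤n) 4≤N

  decide-calls : calls decide (encodeInstance I ∷ []) ≤ N ^ exponent k
  decide-calls = ≤-trans calls≤B^43 (power-bound N q 43 1≤N (exponent≥ k))

  1≤N^exponent : 1 ≤ N ^ exponent k
  1≤N^exponent = ≤-trans (≤-reflexive (sym (^-zeroˡ (exponent k)))) (^-monoˡ-≤ (exponent k) 1≤N)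

reflected : ∀ {P t} → Answers P t → ∃[ b ] Reflects P b × t ≡ encodeBool b
reflected (yes p) = true  , ofʸ p  , refl
reflected (no ¬p) = false , ofⁿ ¬p , refl

theorem15 : InXP DiamClusterCompletion
theorem15 = program decide , exponent , exponent-computable , ∣ decide ∣ᵉ + 60 , λ I →
  let b , reflects , decideᵗ≡b = reflected (decide-answers I)
  in b , reflects , outputs (encodeInstance I) decideᵗ≡b (decide-calls I) (1≤N^exponent I)
  where open Adequacy (program decide) F C F-correct C-correct 60 bodies≤60
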